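{- Let $0<p\le1$ and let $M,M'$ be closed $\mathsf{pPCF}$ terms of type $\sigma$. If $d^p_{\mathrm{obs}}(M,M')=0$ then $M$ and $M'$ are observationally equivalent, i.e. $\mathbb P((C)M\to\underline0)=\mathbb P((C)M'\to\underline0)$ for every closed term $C:\sigma\Rightarrow\mathsf{nat}$.
   Context: **pPCF.** Types $\sigma::=\mathsf{nat}\mid\sigma\Rightarrow\tau$; terms $\underline n$, $\mathsf{succ}(M)$, $\mathsf{pred}(M)$, $x$, $\mathsf{coin}(r)$ ($r\in[0,1]\cap\mathbb Q$), $\mathsf{let}\,x=M\,\mathsf{in}\,N$ ($M:\mathsf{nat}$, $x:\mathsf{nat}$), $\mathsf{if}(M,N,P)$ ($M:\mathsf{nat}$, $N,P:\sigma$), $(M)N$, $\lambda x^\sigma M$, $\mathsf{fix}(M)$ ($M:\sigma\Rightarrow\sigma$), simply typed. $\Omega_\sigma=\mathsf{fix}(\lambda x^\sigma x)$. **Operational semantics.** Stacks $\pi::=\varepsilon\mid\mathsf{arg}(M)\cdot\pi\mid\mathsf{succ}\cdot\pi\mid\mathsf{pred}\cdot\pi\mid\mathsf{if}(N,P)\cdot\pi\mid\mathsf{let}(x,N)\cdot\pi$; states $\langle M,\pi\rangle$ (closed, well-typed, ending in $\mathsf{nat}$). $\mathrm{Eval}(s,\alpha)\in[0,1]$, $\alpha\in\{0,1\}^{<\omega}$, is the least partial function such that $\mathrm{Eval}(\text{lhs},\alpha)=\mathrm{Eval}(\text{rhs},\alpha)$ for each step: $\langle\mathsf{let}\,x=M\,\mathsf{in}\,N,\pi\rangle\to\langle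 M,\mathsf{let}(x,N)\cdot\pi\rangle$, $\langle(M)N,\pi\rangle\to\langle M,\mathsf{arg}(N)\cdot\pi\rangle$, $\langle\mathsf{if}(M,N,P),\pi\rangle\to\langle M,\mathsf{if}(N,P)\cdot\pi\rangle$, $\langle\mathsf{fix}(M),\pi\rangle\to\langle M,\mathsf{arg}(\mathsf{fix}(M))\cdot\pi\rangle$, $\langle\mathsf{succ}(M),\pi\rangle\to\langle M,\mathsf{succ}\cdot\pi\rangle$, $\langle\mathsf{pred}(M),\pi\rangle\to\langle M,\mathsf{pred}\cdot\pi\rangle$, $\langle\underline n,\mathsf{let}(x,N)\cdot\pi\rangle\to\langle N[\underline n/x],\pi\rangle$, $\langle\lambda x^\sigma M,\mathsf{arg}(N)\cdot\pi\rangle\to\langle M[N/x],\pi\rangle$, $\langle\underline0,\mathsf{if}(N,P)\cdot\pi\rangle\to\langle N,\pi\rangle$, $\langle\underline{n+1},\mathsf{if}(N,P)\cdot\pi\rangle\to\langle P,\pi\rangle$, $\langle\underline n,\mathsf{succ}\cdot\pi\rangle\to\langle\underline{n+1},\pi\rangle$, $\langle\underline0,\mathsf{pred}\cdot\pi\rangle\to\langle\underline0,\pi\rangle$, $\langle\underline{n+1},\mathsf{pred}\cdot\pi\rangle\to\langle\underline n,\pi\rangle$; moreover $\mathrm{Eval}(\langle\mathsf{coin}(r),\pi\rangle,i\alpha)=\mathrm{Eval}(\langle\underline i,\pi\rangle,\alpha)\cdot\rho_i(r)$ with $\rho_0(r)=r$, $\rho_1(r)=1-r$, and $\mathrm{Eval}(\langle\underline0,\varepsilon\rangle,\langle\rangle)=1$.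 For closed $M:\mathsf{nat}$, $\mathbb P(M\to\underline0)=\sum\{\mathrm{Eval}(\langle M,\varepsilon\rangle,\alpha)\mid\alpha\text{ where defined}\}$. **Tamed distance.** For closed $C:\sigma\Rightarrow\mathsf{nat}$, $C_p=\lambda z^\sigma(C)\,\mathsf{if}(\mathsf{coin}(p),z,\Omega_\sigma)$, and $d^p_{\mathrm{obs}}(M,M')=\sup_C|\mathbb P((C_p)M\to\underline0)-\mathbb P((C_p)M'\to\underline0)|$ over closed $C:\sigma\Rightarrow\mathsf{nat}$. -}

module Defs where

open import Data.Nat using (ℕ; zero; suc)
open import Data.Bool using (Bool; true; false)
open import Data.List using (List; []; _∷_; map; foldr)
open import Data.List.Relation.Unary.Unique.Propositional using (Unique)
open import Data.Product using (Σ; _×_; _,_; proj₁; proj₂; ∃-syntax)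
open import Data.Rational using (ℚ; 0ℚ; 1ℚ; _+_; _*_; _-_; _≤_; _<_)

infixr 7 _⇒_
data Ty : Set where
  nat : Ty
  _⇒_ : Ty → Ty → Ty

Ctx : Set
Ctx = List Ty

data _∋_ : Ctx → Ty → Set where
  Z : ∀ {Γ σ} → (σ ∷ Γ) ∋ σ
  S : ∀ {Γ σ τ} → Γ ∋ σ → (τ ∷ Γ) ∋ σ

data Tm (Γ : Ctx) : Ty → Set where
  num  : ℕ → Tm Γ nat
  succ : Tm Γ nat → Tm Γ nat
  pred : Tm Γ nat → Tm Γ nat
  var  : ∀ {σ} → Γ ∋ σ → Tm Γ σ
  coin : (r : ℚ) → 0ℚ ≤ r → r ≤ 1ℚ → Tm Γ nat
  lett : ∀ {τ} → Tm Γ nat → Tm (nat ∷ Γ) τ → Tm Γ τ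
  iff  : ∀ {σ} → Tm Γ nat → Tm Γ σ → Tm Γ σ → Tm Γ σ
  app  : ∀ {σ τ} → Tm Γ (σ ⇒ τ) → Tm Γ σ → Tm Γ τ
  lam  : ∀ {σ τ} → Tm (σ ∷ Γ) τ → Tm Γ (σ ⇒ τ)
  fix  : ∀ {σ} → Tm Γ (σ ⇒ σ) → Tm Γ σ

Closed : Ty → Set
Closed σ = Tm [] σ

Ren : Ctx → Ctx → Set
Ren Γ Δ = ∀ {σ} → Γ ∋ σ → Δ ∋ σ

ext : ∀ {Γ Δ τ} → Ren Γ Δ → Ren (τ ∷ Γ) (τ ∷ Δ)
ext ρ Z     = Z
ext ρ (S x) = S (ρ x)

rename : ∀ {Γ Δ σ} → Ren Γ Δ → Tm Γ σ → Tm Δ σ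
rename ρ (num n)        = num n
rename ρ (succ M)       = succ (rename ρ M)
rename ρ (pred M)       = pred (rename ρ M)
rename ρ (var x)        = var (ρ x)
rename ρ (coin r p q)   = coin r p q
rename ρ (lett M N)     = lett (rename ρ M) (rename (ext ρ) N)
rename ρ (iff M N P)    = iff (rename ρ M) (rename ρ N) (rename ρ P)
rename ρ (app M N)      = app (rename ρ M) (rename ρ N)
rename ρ (lam M)        = lam (rename (ext ρ) M)
rename ρ (fix M)        = fix (rename ρ M)

Sub : Ctx → Ctx → Set
Sub Γ Δ = ∀ {σ} → Γ ∋ σ → Tm Δ σ

exts : ∀ {Γ Δ τ} → Sub Γ Δ → Sub (τ ∷ Γ) (τ ∷ Δ)
exts s Z     = var Z
exts s (S x) = rename S (s x)

subst : ∀ {Γ Δ σ} → Sub Γ Δ → Tm Γ σ → Tm Δ σ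
subst s (num n)        = num n
subst s (succ M)       = succ (subst s M)
subst s (pred M)       = pred (subst s M)
subst s (var x)        = s x
subst s (coin r p q)   = coin r p q
subst s (lett M N)     = lett (subst s M) (subst (exts s) N)
subst s (iff M N P)    = iff (subst s M) (subst s N) (subst s P)
subst s (app M N)      = app (subst s M) (subst s N)
subst s (lam M)        = lam (subst (exts s) M)
subst s (fix M)        = fix (subst s M)

_[_] : ∀ {Γ σ τ} → Tm (σ ∷ Γ) τ → Tm Γ σ → Tm Γ τ
_[_] {Γ} {σ} M N = subst s M
  where
  s : Sub (σ ∷ Γ) Γ
  s Z     = N
  s (S x) = var x

weaken : ∀ {σ τ} → Closed τ → Tm (σ ∷ []) τ
weaken = rename (λ ())

-- Stacks and states (Krivine-style machine); a stack of type  Stack σ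
-- accepts a term of type σ and the whole state ends in nat.

data Stack : Ty → Set where
  ε     : Stack nat
  arg   : ∀ {σ τ} → Closed σ → Stack τ → Stack (σ ⇒ τ)
  succS : Stack nat → Stack nat
  predS : Stack nat → Stack nat
  ifS   : ∀ {σ} → Closed σ → Closed σ → Stack σ → Stack nat
  letS  : ∀ {τ} → Tm (nat ∷ []) τ → Stack τ → Stack nat

record State : Set where
  constructor ⟨_,_⟩
  field
    {ty}  : Ty
    term  : Closed ty
    stack : Stack ty

ρ : Bool → ℚ → ℚ
ρ false r = r
ρ true  r = 1ℚ - r

bitNum : Bool → ℕ
bitNum false = 0
bitNum true  = 1

-- Eval s α q  :  "Eval(s, α) is defined and equals q".
-- The least partial function satisfying the equations is exactly the
-- graph inductively generated by them.
data Eval : State → List Bool → ℚ → Set where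
  e-let   : ∀ {τ α q} {M : Closed nat} {N : Tm (nat ∷ []) τ} {π : Stack τ} →
            Eval ⟨ M , letS N π ⟩ α q → Eval ⟨ lett M N , π ⟩ α q
  e-app   : ∀ {σ τ α q} {M : Closed (σ ⇒ τ)} {N : Closed σ} {π : Stack τ} →
            Eval ⟨ M , arg N π ⟩ α q → Eval ⟨ app M N , π ⟩ α q
  e-if    : ∀ {σ α q} {M : Closed nat} {N P : Closed σ} {π : Stack σ} →
            Eval ⟨ M , ifS N P π ⟩ α q → Eval ⟨ iff M N P , π ⟩ α q
  e-fix   : ∀ {σ α q} {M : Closed (σ ⇒ σ)} {π : Stack σ} →
            Eval ⟨ M , arg (fix M) π ⟩ α q → Eval ⟨ fix M , π ⟩ α q
  e-succ  : ∀ {α q} {M : Closed nat} {π : Stack nat} →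
            Eval ⟨ M , succS π ⟩ α q → Eval ⟨ succ M , π ⟩ α q
  e-pred  : ∀ {α q} {M : Closed nat} {π : Stack nat} →
            Eval ⟨ M , predS π ⟩ α q → Eval ⟨ pred M , π ⟩ α q
  e-letv  : ∀ {τ α q n} {N : Tm (nat ∷ []) τ} {π : Stack τ} →
            Eval ⟨ N [ num n ] , π ⟩ α q → Eval ⟨ num n , letS N π ⟩ α q
  e-beta  : ∀ {σ τ α q} {M : Tm (σ ∷ []) τ} {N : Closed σ} {π : Stack τ} →
            Eval ⟨ M [ N ] , π ⟩ α q → Eval ⟨ lam M , arg N π ⟩ α q
  e-if0   : ∀ {σ α q} {N P : Closed σ} {π : Stack σ} →
            Eval ⟨ N , π ⟩ α q → Eval ⟨ num 0 , ifS N P π ⟩ α q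
  e-ifS   : ∀ {σ α q n} {N P : Closed σ} {π : Stack σ} →
            Eval ⟨ P , π ⟩ α q → Eval ⟨ num (suc n) , ifS N P π ⟩ α q
  e-succv : ∀ {α q n} {π : Stack nat} →
            Eval ⟨ num (suc n) , π ⟩ α q → Eval ⟨ num n , succS π ⟩ α q
  e-pred0 : ∀ {α q} {π : Stack nat} →
            Eval ⟨ num 0 , π ⟩ α q → Eval ⟨ num 0 , predS π ⟩ α q
  e-predS : ∀ {α q n} {π : Stack nat} →
            Eval ⟨ num n , π ⟩ α q → Eval ⟨ num (suc n) , predS π ⟩ α q
  e-coin  : ∀ {α q r} {0≤r : 0ℚ ≤ r} {r≤1 : r ≤ 1ℚ} {π : Stack nat} (i : Bool) →
            Eval ⟨ num (bitNum i) , π ⟩ α q →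
            Eval ⟨ coin r 0≤r r≤1 , π ⟩ (i ∷ α) (q * ρ i r)
  e-done  : Eval ⟨ num 0 , ε ⟩ [] 1ℚ

-- P(M → 0) = Σ { Eval(⟨M,ε⟩, α) | α where defined }, a sum of
-- nonnegative rationals.  Without real numbers we describe it through its
-- finite partial sums: a "finite part" is a list of pairwise distinct
-- α's together with their (defined) values.

FinitePart : Closed nat → Set
FinitePart M = Σ (List (Σ (List Bool) λ α → Σ ℚ λ q → Eval ⟨ M , ε ⟩ α q))
                 λ L → Unique (map proj₁ L)

partSum : ∀ {M} → FinitePart M → ℚ
partSum (L , _) = foldr (λ e acc → proj₁ (proj₂ e) + acc) 0ℚ L

_≤ℙ_ : Closed nat → Closed nat → Set
M ≤ℙ M' = (F : FinitePart M) (e : ℚ) → 0ℚ < e →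
          ∃[ G ] (partSum {M} F ≤ partSum {M'} G + e)

_≡ℙ_ : Closed nat → Closed nat → Set
M ≡ℙ M' = (M ≤ℙ M') × (M' ≤ℙ M)

Ω : ∀ {Γ} σ → Tm Γ σ
Ω σ = fix (lam (var Z))

tame : ∀ {σ} (p : ℚ) → 0ℚ ≤ p → p ≤ 1ℚ → Closed (σ ⇒ nat) → Closed (σ ⇒ nat)
tame {σ} p 0≤p p≤1 C = lam (app (weaken C) (iff (coin p 0≤p p≤1) (var Z) (Ω σ)))

-- d^p_obs(M, M') = 0 : the supremum of the nonnegative quantities
-- |P((C_p)M → 0) − P((C_p)M' → 0)| vanishes iff each of them vanishes.
dObsZero : ∀ {σ} (p : ℚ) → 0ℚ ≤ p → p ≤ 1ℚ → Closed σ → Closed σ → Set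
dObsZero {σ} p 0≤p p≤1 M M' =
  (C : Closed (σ ⇒ nat)) → app (tame p 0≤p p≤1 C) M ≡ℙ app (tame p 0≤p p≤1 C) M'

ObsEquiv : ∀ {σ} → Closed σ → Closed σ → Set
ObsEquiv {σ} M M' = (C : Closed (σ ⇒ nat)) → app C M ≡ℙ app C M'

{-# OPTIONS --safe #-}

-- Run C on a variable z and let a k be the probability of accepting after exactly k calls
-- of z, each answered by M; let b k be the same for M′.  Answering a call only with
-- probability t, and diverging otherwise, turns the acceptance probability Σ a k into
-- Σ a k tᵏ.  Since the hypothesis also covers the tamed versions of C, it says that
-- Σ a k tᵏ = Σ b k tᵏ for all rational t ∈ (0, p].  Letting t → 0 gives a 0 = b 0;
-- cancelling this term, dividing by t and iterating gives a k = b k for all k, and t = 1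
-- is the claim.  All the numbers are suprema of increasing sequences of rationals.
module Submission where

open import Defs
open import Data.Bool.Base using (Bool; true; false)
open import Data.Empty using (⊥)
open import Data.Integer.Base as ℤ using ()
open import Data.Integer.Tactic.RingSolver using () renaming (solve-∀ to ℤ-solve-∀)
open import Data.List.Base using (List; []; _∷_; map; foldr; _++_)
open import Data.List.Membership.Propositional using (_∈_)
open import Data.List.Membership.Propositional.Properties using (∈-map⁻)
open import Data.List.Properties using (∷-injective; map-++; map-∘)
open import Data.List.Relation.Unary.All as All using (All; []; _∷_)
open import Data.List.Relation.Unary.AllPairs using ([]; _∷_)
open import Data.List.Relation.Unary.Unique.Propositional using (Unique)
import Data.List.Relation.Unary.Unique.Propositional.Properties as Unique
open import Data.Nat.Base as ℕ using (ℕ; zero; suc)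
import Data.Nat.Properties as ℕ
open import Data.Product using (Σ; ∃₂; _×_; _,_; proj₁; proj₂; ∃-syntax)
open import Data.Rational
  using (ℚ; mkℚ; 0ℚ; 1ℚ; ½; _+_; _*_; _-_; -_; _≤_; _<_; _⊓_; _≤?_; *<*; positive; nonNegative; ↥_; ↧_; 1/_)
import Data.Rational.Base as ℚ
open import Data.Rational.Properties as ℚ using (module ≤-Reasoning)
open import Data.Rational.Solver using (module +-*-Solver)
open +-*-Solver using (solve; _:=_; _:+_; _:*_; _:-_; con)
import Data.Rational.Unnormalised.Base as ℚᵘ
import Data.Rational.Unnormalised.Properties as ℚᵘ
open import Data.Sum using (_⊎_; inj₁; inj₂)
open import Data.Unit.Base using (⊤; tt)
open import Function using (_∘_)
open import Relation.Binary.PropositionalEquality as Eq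
  using (_≡_; _≢_; refl; sym; trans; cong; cong₂; module ≡-Reasoning)
open import Relation.Nullary using (yes; no)
open import Relation.Nullary.Decidable using (from-yes)
open import Relation.Nullary.Negation using (contradiction)

-- Probabilities enter only through the step-bounded rationals `prob n s`, and every comparison has
-- the form: for each stage and each `e` > 0 some stage on the other side loses at most `e`.
-- Cancelling a coefficient is therefore not a subtraction. It takes place between two stages of the
-- same supremum and uses the reverse inequality of the heads, which is why both directions travel
-- through the induction together.
--
-- The coefficients a k can be defined without t because the machine runs on the open term: the
-- variable stays in place, and the answering term is inserted only when the variable reaches the
-- head. Guarding the answer then changes nothing but the weight of a call and the number of steps
-- it takes. A closed run of `n` steps involves only the coefficients below `n * 2`, so finitely
-- many comparisons of coefficients settle each stage.

-- Inequalities between rationals and the Archimedean property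

-- The certificate  q - p = d - c  with both sides moved, so that ring identities
-- settle linear inequalities.
linear : ∀ {p q c d} → c ≤ d → p + d ≡ q + c → p ≤ q
linear {p} {q} {c} {d} c≤d eq = begin
  p           ≡⟨ undo p c ⟩
  (p + c) - c ≤⟨ ℚ.+-monoˡ-≤ (- c) (ℚ.+-monoʳ-≤ p c≤d) ⟩
  (p + d) - c ≡⟨ cong (_- c) eq ⟩
  (q + c) - c ≡⟨ undo q c ⟨
  q           ∎
  where
  open ≤-Reasoning
  undo : ∀ x y → x ≡ x + y - y
  undo = solve 2 (λ x y → x := x :+ y :- y) refl

*-monoʳ : ∀ {r p q} → 0ℚ ≤ r → p ≤ q → r * p ≤ r * q
*-monoʳ {r} 0≤r = ℚ.*-monoˡ-≤-nonNeg r {{nonNegative 0≤r}}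

*-monoˡ : ∀ {r p q} → 0ℚ ≤ r → p ≤ q → p * r ≤ q * r
*-monoˡ {r} 0≤r = ℚ.*-monoʳ-≤-nonNeg r {{nonNegative 0≤r}}

*-nonneg : ∀ {p q} → 0ℚ ≤ p → 0ℚ ≤ q → 0ℚ ≤ p * q
*-nonneg {p} {q} 0≤p 0≤q = ℚ.≤-trans (ℚ.≤-reflexive (sym (ℚ.*-zeroʳ p))) (*-monoʳ {p} {0ℚ} {q} 0≤p 0≤q)

*-pos : ∀ {p q} → 0ℚ < p → 0ℚ < q → 0ℚ < p * q
*-pos {p} {q} 0<p 0<q =
  ℚ.positive⁻¹ (p * q) {{ℚ.pos*pos⇒pos p {{positive 0<p}} q {{positive 0<q}}}}

+-nonneg : ∀ {p q} → 0ℚ ≤ p → 0ℚ ≤ q → 0ℚ ≤ p + q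
+-nonneg {p} {q} 0≤p 0≤q = ℚ.+-mono-≤ {0ℚ} {p} {0ℚ} {q} 0≤p 0≤q

0≤1 : 0ℚ ≤ 1ℚ
0≤1 = from-yes (0ℚ ≤? 1ℚ)

0<½ : 0ℚ < ½
0<½ = from-yes (0ℚ ℚ.<? ½)

half-pos : ∀ {e} → 0ℚ < e → 0ℚ < ½ * e
half-pos = *-pos 0<½

halves : ∀ e → ½ * e + ½ * e ≡ e
halves e = trans (sym (ℚ.*-distribʳ-+ e ½ ½)) (ℚ.*-identityˡ e)

half≤ : ∀ {e} → 0ℚ < e → ½ * e ≤ e
half≤ {e} 0<e = begin
  ½ * e           ≡⟨ ℚ.+-identityʳ (½ * e) ⟨
  ½ * e + 0ℚ      ≤⟨ ℚ.+-monoʳ-≤ (½ * e) (ℚ.<⇒≤ (half-pos 0<e)) ⟩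
  ½ * e + ½ * e   ≡⟨ halves e ⟩
  e               ∎
  where open ≤-Reasoning

multiple : ℕ → ℚ → ℚ
multiple zero    r = 0ℚ
multiple (suc n) r = r + multiple n r

multiple-toℚᵘ : ∀ n r → ℚ.toℚᵘ (multiple n r) ℚᵘ.≃ ℚᵘ.mkℚᵘ (ℤ.+ n ℤ.* ↥ r) (ℚ.denominator-1 r)
multiple-toℚᵘ zero    r@record{} = ℚᵘ.*≡* refl
multiple-toℚᵘ (suc n) r@record{} = begin
  ℚ.toℚᵘ (r + multiple n r)               ≈⟨ ℚ.toℚᵘ-homo-+ r (multiple n r) ⟩
  ℚ.toℚᵘ r ℚᵘ.+ ℚ.toℚᵘ (multiple n r)       ≈⟨ ℚᵘ.+-congʳ (ℚ.toℚᵘ r) (multiple-toℚᵘ n r) ⟩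
  ℚ.toℚᵘ r ℚᵘ.+ ℚᵘ.mkℚᵘ (ℤ.+ n ℤ.* ↥ r) (ℚ.denominator-1 r) ≈⟨ ℚᵘ.*≡* (same (↥ r) (↧ r) (ℤ.+ n)) ⟩
  ℚᵘ.mkℚᵘ (ℤ.+ (suc n) ℤ.* ↥ r) (ℚ.denominator-1 r) ∎
  where
  open import Relation.Binary.Reasoning.Setoid ℚᵘ.≃-setoid
  same : ∀ a d m → (a ℤ.* d ℤ.+ (m ℤ.* a) ℤ.* d) ℤ.* d ≡ ((ℤ.1ℤ ℤ.+ m) ℤ.* a) ℤ.* (d ℤ.* d)
  same = ℤ-solve-∀

-- The denominator of `r` suffices: that many copies of `r` add up to its numerator, a positive
-- integer.
archimedean : ∀ {r} → 0ℚ < r → ∃[ n ] 1ℚ ≤ multiple n r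
archimedean {r@(mkℚ ℤ.+[1+ k ] d-1 _)} 0<r = suc d-1 , ℚ.toℚᵘ-cancel-≤ (begin
  ℚᵘ.1ℚᵘ ≤⟨ ℚᵘ.*≤* (ℤ.+≤+ (ℕ.≤-trans (ℕ.≤-reflexive (ℕ.+-identityʳ (suc d-1)))
      (ℕ.≤-trans (ℕ.m≤m*n (suc d-1) (suc k)) (ℕ.≤-reflexive (sym (ℕ.*-identityʳ _)))))) ⟩
  ℚᵘ.mkℚᵘ (ℤ.+ (suc d-1) ℤ.* ↥ r) d-1 ≃⟨ ℚᵘ.≃-sym (multiple-toℚᵘ (suc d-1) r) ⟩
  ℚ.toℚᵘ (multiple (suc d-1) r) ∎)
  where open ℚᵘ.≤-Reasoning
archimedean {mkℚ ℤ.+0 d-1 _} (*<* (ℤ.+<+ ()))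
archimedean {mkℚ (ℤ.-[1+ k ]) d-1 _} (*<* ())

-- Power series whose coefficients are suprema of sequences of rationals

-- Horner form of the truncated power series, so that splitting off the constant term and a factor
-- `t` is definitional.
series : ℕ → (ℕ → ℚ) → ℚ → ℚ
series zero    a t = 0ℚ
series (suc K) a t = a 0 + t * series K (a ∘ suc) t

series-nonneg : ∀ K {a t} → 0ℚ ≤ t → (∀ k → 0ℚ ≤ a k) → 0ℚ ≤ series K a t
series-nonneg zero    0≤t 0≤a = ℚ.≤-refl
series-nonneg (suc K) 0≤t 0≤a = +-nonneg (0≤a 0) (*-nonneg 0≤t (series-nonneg K 0≤t (0≤a ∘ suc)))

series-mono : ∀ K {a b t} → 0ℚ ≤ t → (∀ k → a k ≤ b k) → series K a t ≤ series K b t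
series-mono zero    0≤t a≤b = ℚ.≤-refl
series-mono (suc K) 0≤t a≤b = ℚ.+-mono-≤ (a≤b 0) (*-monoʳ 0≤t (series-mono K 0≤t (a≤b ∘ suc)))

series-length-mono : ∀ {K L a t} → K ℕ.≤ L → 0ℚ ≤ t → (∀ k → 0ℚ ≤ a k) → series K a t ≤ series L a t
series-length-mono {L = L} ℕ.z≤n 0≤t 0≤a = series-nonneg L 0≤t 0≤a
series-length-mono {a = a} (ℕ.s≤s K≤L) 0≤t 0≤a =
  ℚ.+-monoʳ-≤ (a 0) (*-monoʳ 0≤t (series-length-mono K≤L 0≤t (0≤a ∘ suc)))

series≤series₁ : ∀ K {a t} → 0ℚ ≤ t → t ≤ 1ℚ → (∀ k → 0ℚ ≤ a k) → series K a t ≤ series K a 1ℚ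
series≤series₁ zero    0≤t t≤1 0≤a = ℚ.≤-refl
series≤series₁ (suc K) {a} {t} 0≤t t≤1 0≤a = ℚ.+-monoʳ-≤ (a 0) (ℚ.≤-trans
  (*-monoʳ 0≤t (series≤series₁ K 0≤t t≤1 (0≤a ∘ suc)))
  (*-monoˡ (series-nonneg K 0≤1 (0≤a ∘ suc)) t≤1))

series-constant : ∀ a t → series 1 a t ≡ a 0
series-constant a t = trans (cong (a 0 +_) (ℚ.*-zeroʳ t)) (ℚ.+-identityʳ (a 0))

-- The true coefficients are the suprema over `n` of `a n k`. The bound at 1 says that they form a
-- subprobability distribution on the number of calls.
record Approximation (a : ℕ → ℕ → ℚ) : Set where
  field
    nonneg  : ∀ n k → 0ℚ ≤ a n k
    mono    : ∀ {m n} → m ℕ.≤ n → ∀ k → a m k ≤ a n k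
    bounded : ∀ K n → series K (a n) 1ℚ ≤ 1ℚ

open Approximation

tail : (ℕ → ℕ → ℚ) → ℕ → ℕ → ℚ
tail a n = a n ∘ suc

tail-approximation : ∀ {a} → Approximation a → Approximation (tail a)
tail-approximation A .nonneg n k = A .nonneg n (suc k)
tail-approximation A .mono m≤n k = A .mono m≤n (suc k)
tail-approximation {a} A .bounded K n = begin
  series K (tail a n) 1ℚ                ≡⟨ ℚ.*-identityˡ s ⟨
  1ℚ * series K (tail a n) 1ℚ           ≡⟨ ℚ.+-identityˡ (1ℚ * s) ⟨
  0ℚ + 1ℚ * series K (tail a n) 1ℚ      ≤⟨ ℚ.+-monoˡ-≤ (1ℚ * s) (A .nonneg n 0) ⟩
  a n 0 + 1ℚ * series K (tail a n) 1ℚ   ≤⟨ A .bounded (suc K) n ⟩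
  1ℚ                                    ∎
  where
  open ≤-Reasoning
  s : ℚ
  s = series K (tail a n) 1ℚ

head≤1 : ∀ {a} → Approximation a → ∀ n → a n 0 ≤ 1ℚ
head≤1 {a} A n = ℚ.≤-trans (ℚ.≤-reflexive (sym (series-constant (a n) 1ℚ))) (A .bounded 1 n)

-- The inequality between the two infinite sums at `t`; truncation and stage on the right may depend
-- on those on the left.
_≤[_]_ : (ℕ → ℕ → ℚ) → ℚ → (ℕ → ℕ → ℚ) → Set
a ≤[ t ] b = ∀ K n e → 0ℚ < e → ∃₂ λ L m → series K (a n) t ≤ series L (b m) t + e

-- A sequence bounded by 1 cannot increase by more than δ at each step.
settle : (u : ℕ → ℚ) → (∀ n → u n ≤ 1ℚ) → (next : ℕ → ℕ) → (∀ n → n ℕ.≤ next n) →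
         ∀ {δ} → 0ℚ < δ → ∀ j n → 1ℚ ≤ u n + multiple j δ →
         ∃[ n′ ] n ℕ.≤ n′ × u (next n′) ≤ u n′ + δ
settle u u≤1 next n≤next {δ} 0<δ zero n 1≤ = n , ℕ.≤-refl , (begin
  u (next n) ≤⟨ u≤1 (next n) ⟩
  1ℚ         ≤⟨ 1≤ ⟩
  u n + 0ℚ   ≤⟨ ℚ.+-monoʳ-≤ (u n) (ℚ.<⇒≤ 0<δ) ⟩
  u n + δ    ∎)
  where open ≤-Reasoning
settle u u≤1 next n≤next {δ} 0<δ (suc j) n 1≤ with u (next n) ≤? u n + δ
... | yes small = n , ℕ.≤-refl , small
... | no  large =
  let n′ , next≤n′ , small = settle u u≤1 next n≤next 0<δ j (next n) (begin
        1ℚ                              ≤⟨ 1≤ ⟩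
        u n + (δ + multiple j δ)        ≡⟨ ℚ.+-assoc (u n) δ (multiple j δ) ⟨
        u n + δ + multiple j δ          ≤⟨ ℚ.+-monoˡ-≤ (multiple j δ) (ℚ.<⇒≤ (ℚ.≰⇒> large)) ⟩
        u (next n) + multiple j δ       ∎)
  in n′ , ℕ.≤-trans (n≤next n) next≤n′ , small
  where open ≤-Reasoning

series≤head : ∀ {a} → Approximation a → ∀ L n {t} → 0ℚ ≤ t →
              series L (a n) t ≤ a n 0 + t * series L (tail a n) t
series≤head A L n 0≤t = series-length-mono (ℕ.n≤1+n L) 0≤t (A .nonneg n)

-- The limit t → 0, taken at the single value `p ⊓ ½ * e`: there the higher terms of `b` contribute
-- at most `t` times a subprobability, hence at most `½ * e`, and the other half of `e` is the slack
-- of the hypothesis.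
head≤ : ∀ {a b} → Approximation a → Approximation b → ∀ {p} → 0ℚ < p → p ≤ 1ℚ →
        (∀ t → 0ℚ < t → t ≤ p → a ≤[ t ] b) →
        ∀ n e → 0ℚ < e → ∃[ m ] a n 0 ≤ b m 0 + e
head≤ {a} {b} A B {p} 0<p p≤1 a≤b n e 0<e = m , (begin
  a n 0                                                   ≡⟨ series-constant (a n) t ⟨
  series 1 (a n) t                                        ≤⟨ a≤bm ⟩
  series L (b m) t + ½ * e                                ≤⟨ ℚ.+-monoˡ-≤ (½ * e) (series≤head B L m 0≤t) ⟩
  b m 0 + t * series L (tail b m) t + ½ * e               ≤⟨ ℚ.+-monoˡ-≤ (½ * e) (ℚ.+-monoʳ-≤ (b m 0) t*s≤) ⟩
  b m 0 + ½ * e + ½ * e                                   ≡⟨ ℚ.+-assoc (b m 0) (½ * e) (½ * e) ⟩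
  b m 0 + (½ * e + ½ * e)                                 ≡⟨ cong (b m 0 +_) (halves e) ⟩
  b m 0 + e                                               ∎)
  where
  open ≤-Reasoning
  t = p ⊓ (½ * e)
  0<t : 0ℚ < t
  0<t with ℚ.⊓-sel p (½ * e)
  ... | inj₁ eq = ℚ.<-respʳ-≡ (sym eq) 0<p
  ... | inj₂ eq = ℚ.<-respʳ-≡ (sym eq) (half-pos 0<e)
  0≤t = ℚ.<⇒≤ 0<t
  t≤p = ℚ.p⊓q≤p p (½ * e)
  found = a≤b t 0<t t≤p 1 n (½ * e) (half-pos 0<e)
  L = proj₁ found
  m = proj₁ (proj₂ found)
  a≤bm = proj₂ (proj₂ found)
  t*s≤ : t * series L (tail b m) t ≤ ½ * e
  t*s≤ = begin
    t * series L (tail b m) t  ≤⟨ *-monoʳ 0≤t (series≤series₁ L 0≤t (ℚ.≤-trans t≤p p≤1) (tail-approximation B .nonneg m)) ⟩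
    t * series L (tail b m) 1ℚ ≤⟨ *-monoʳ 0≤t (tail-approximation B .bounded L m) ⟩
    t * 1ℚ                     ≡⟨ ℚ.*-identityʳ t ⟩
    t                          ≤⟨ ℚ.p⊓q≤q p (½ * e) ⟩
    ½ * e                      ∎

-- The head a 0 = b 0 is only a supremum of rationals, so it is cancelled at a stage n′
-- from which the approximation of a 0 no longer grows appreciably.
tail≤ : ∀ {a b} → Approximation a → Approximation b → ∀ {t} → 0ℚ < t →
        a ≤[ t ] b → (∀ n e → 0ℚ < e → ∃[ m ] b n 0 ≤ a m 0 + e) →
        tail a ≤[ t ] tail b
tail≤ {a} {b} A B {t} 0<t a≤b b₀≤a₀ K n e 0<e =
  L n′ , m n′ , ℚ.*-cancelˡ-≤-pos t {{positive 0<t}} (begin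
    -- In the sum of the three inequalities the heads at stages `n′` and `next n′` and the term
    -- `t * X′` occur on both sides and drop out.
    t * X                     ≤⟨ linear (ℚ.+-mono-≤ (step n′) (ℚ.+-mono-≤ settled X≤X′))
                                   (balance (t * X) (t * X′) (a n′ 0) (a (next n′) 0) (t * Y n′) d) ⟩
    t * Y n′ + (d + (d + d))  ≤⟨ ℚ.+-monoʳ-≤ (t * Y n′) 3d≤ ⟩
    t * Y n′ + t * e          ≡⟨ ℚ.*-distribˡ-+ t (Y n′) e ⟨
    t * (Y n′ + e)            ∎)
  where
  open ≤-Reasoning
  balance : ∀ x x′ u u′ y d →
            x + (u′ + d + y + d + (u + d + x′)) ≡ y + (d + (d + d)) + (u + x′ + (u′ + x))
  balance = solve 6 (λ x x′ u u′ y d →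
    x :+ (u′ :+ d :+ y :+ d :+ (u :+ d :+ x′)) := y :+ (d :+ (d :+ d)) :+ (u :+ x′ :+ (u′ :+ x))) refl
  0≤t = ℚ.<⇒≤ 0<t
  X = series K (tail a n) t
  0<te = *-pos 0<t 0<e
  -- An error `d` arises three times: from `a≤b`, from `b₀≤a₀` and from `settle`. The factor `t` in
  -- it survives the final division by `t`.
  d = ½ * (½ * (t * e))
  0<d : 0ℚ < d
  0<d = half-pos (half-pos 0<te)
  3d≤ : d + (d + d) ≤ t * e
  3d≤ = begin
    d + (d + d)                          ≡⟨ cong (d +_) (halves (½ * (t * e))) ⟩
    d + ½ * (t * e)                      ≤⟨ ℚ.+-monoˡ-≤ (½ * (t * e)) (half≤ (half-pos 0<te)) ⟩
    ½ * (t * e) + ½ * (t * e)            ≡⟨ halves (t * e) ⟩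
    t * e                                ∎
  found : ∀ i → ∃₂ λ L m → series (suc K) (a i) t ≤ series L (b m) t + d
  found i = a≤b (suc K) i d 0<d
  L m next : ℕ → ℕ
  L i = proj₁ (found i)
  m i = proj₁ (proj₂ (found i))
  back : ∀ i → ∃[ j ] b (m i) 0 ≤ a j 0 + d
  back i = b₀≤a₀ (m i) d 0<d
  -- From stage `i` of `a` to stage `m i` of `b` and back: at `next i` the head of `a` dominates, up
  -- to `d`, the head of `b` that `found i` produced.
  next i = i ℕ.⊔ proj₁ (back i)
  Y : ℕ → ℚ
  Y i = series (L i) (tail b (m i)) t
  step : ∀ i → a i 0 + t * series K (tail a i) t ≤ a (next i) 0 + d + t * Y i + d
  step i = begin
    a i 0 + t * series K (tail a i) t    ≤⟨ proj₂ (proj₂ (found i)) ⟩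
    series (L i) (b (m i)) t + d         ≤⟨ ℚ.+-monoˡ-≤ d (series≤head B (L i) (m i) 0≤t) ⟩
    b (m i) 0 + t * Y i + d              ≤⟨ ℚ.+-monoˡ-≤ d (ℚ.+-monoˡ-≤ (t * Y i) (begin
      b (m i) 0                            ≤⟨ proj₂ (back i) ⟩
      a (proj₁ (back i)) 0 + d             ≤⟨ ℚ.+-monoˡ-≤ d (A .mono (ℕ.m≤n⊔m i (proj₁ (back i))) 0) ⟩
      a (next i) 0 + d                     ∎)) ⟩
    a (next i) 0 + d + t * Y i + d       ∎
  arch = archimedean 0<d
  settling = settle (λ i → a i 0) (head≤1 A) next (λ i → ℕ.m≤m⊔n i (proj₁ (back i))) 0<d
    (proj₁ arch) n (begin
      1ℚ                               ≤⟨ proj₂ arch ⟩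
      multiple (proj₁ arch) d          ≡⟨ ℚ.+-identityˡ _ ⟨
      0ℚ + multiple (proj₁ arch) d     ≤⟨ ℚ.+-monoˡ-≤ (multiple (proj₁ arch) d) (A .nonneg n 0) ⟩
      a n 0 + multiple (proj₁ arch) d  ∎)
  n′ = proj₁ settling
  settled = proj₂ (proj₂ settling)
  X′ = series K (tail a n′) t
  X≤X′ : t * X ≤ t * X′
  X≤X′ = *-monoʳ 0≤t (series-mono K 0≤t (tail-approximation A .mono (proj₁ (proj₂ settling))))

-- Comparing one coefficient at a time is what permits the jump from t ≤ p to t = 1. Both directions
-- are assumed because `tail≤` in one direction consumes `head≤` in the other, and the tails must
-- again satisfy both.
series₁≤ : ∀ {p} → 0ℚ < p → p ≤ 1ℚ → ∀ K {a b} → Approximation a → Approximation b →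
           (∀ t → 0ℚ < t → t ≤ p → a ≤[ t ] b) → (∀ t → 0ℚ < t → t ≤ p → b ≤[ t ] a) →
           ∀ n e → 0ℚ < e → ∃[ m ] series K (a n) 1ℚ ≤ series K (b m) 1ℚ + e
series₁≤ 0<p p≤1 zero A B a≤b b≤a n e 0<e = 0 , ℚ.+-monoʳ-≤ 0ℚ (ℚ.<⇒≤ 0<e)
series₁≤ 0<p p≤1 (suc K) {a} {b} A B a≤b b≤a n e 0<e =
  let a₀≤ = head≤ A B 0<p p≤1 a≤b
      b₀≤ = head≤ B A 0<p p≤1 b≤a
      m₀ , h = a₀≤ n (½ * e) (half-pos 0<e)
      m₁ , g = series₁≤ 0<p p≤1 K (tail-approximation A) (tail-approximation B)
                 (λ t 0<t t≤p → tail≤ A B 0<t (a≤b t 0<t t≤p) b₀≤)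
                 (λ t 0<t t≤p → tail≤ B A 0<t (b≤a t 0<t t≤p) a₀≤) n (½ * e) (half-pos 0<e)
      m  = m₀ ℕ.⊔ m₁
      s  = series K (tail b m₁) 1ℚ
      s′ = series K (tail b m) 1ℚ
  in m , (begin
    a n 0 + 1ℚ * series K (tail a n) 1ℚ ≤⟨ ℚ.+-mono-≤ h (*-monoʳ 0≤1 g) ⟩
    b m₀ 0 + ½ * e + 1ℚ * (s + ½ * e)   ≤⟨ ℚ.+-mono-≤ (ℚ.+-monoˡ-≤ (½ * e) (B .mono (ℕ.m≤m⊔n m₀ m₁) 0))
                                             (*-monoʳ 0≤1 (ℚ.+-monoˡ-≤ (½ * e)
                                               (series-mono K 0≤1 (tail-approximation B .mono (ℕ.m≤n⊔m m₀ m₁))))) ⟩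
    b m 0 + ½ * e + 1ℚ * (s′ + ½ * e)   ≡⟨ regroup (b m 0) (½ * e) s′ ⟩
    b m 0 + 1ℚ * s′ + (½ * e + ½ * e)   ≡⟨ cong (b m 0 + 1ℚ * s′ +_) (halves e) ⟩
    b m 0 + 1ℚ * s′ + e                 ∎)
  where
  open ≤-Reasoning
  regroup : ∀ x h y → x + h + 1ℚ * (y + h) ≡ x + 1ℚ * y + (h + h)
  regroup = solve 3 (λ x h y →
    x :+ h :+ con 1ℚ :* (y :+ h) := x :+ con 1ℚ :* y :+ (h :+ h)) refl

-- Substitution

cong₃ : ∀ {A B C D : Set} (f : A → B → C → D) {a a′ b b′ c c′} →
        a ≡ a′ → b ≡ b′ → c ≡ c′ → f a b c ≡ f a′ b′ c′
cong₃ f refl refl refl = refl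

exts-cong : ∀ {Γ Δ} {s s′ : Sub Γ Δ} → (∀ {σ} (x : Γ ∋ σ) → s x ≡ s′ x) →
            ∀ {σ τ} (x : (τ ∷ Γ) ∋ σ) → exts s x ≡ exts s′ x
exts-cong eq Z     = refl
exts-cong eq (S x) = cong (rename S) (eq x)

subst-cong : ∀ {Γ Δ} {s s′ : Sub Γ Δ} → (∀ {σ} (x : Γ ∋ σ) → s x ≡ s′ x) →
             ∀ {σ} (M : Tm Γ σ) → subst s M ≡ subst s′ M
subst-cong eq (num n)      = refl
subst-cong eq (succ M)     = cong succ (subst-cong eq M)
subst-cong eq (pred M)     = cong pred (subst-cong eq M)
subst-cong eq (var x)      = eq x
subst-cong eq (coin r p q) = refl
subst-cong eq (lett M N)   = cong₂ lett (subst-cong eq M) (subst-cong (exts-cong eq) N)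
subst-cong eq (iff M N P)  = cong₃ iff (subst-cong eq M) (subst-cong eq N) (subst-cong eq P)
subst-cong eq (app M N)    = cong₂ app (subst-cong eq M) (subst-cong eq N)
subst-cong eq (lam M)      = cong lam (subst-cong (exts-cong eq) M)
subst-cong eq (fix M)      = cong fix (subst-cong eq M)

exts-var : ∀ {Γ Δ} {s : Sub Γ Δ} {r : Ren Γ Δ} → (∀ {σ} (x : Γ ∋ σ) → s x ≡ var (r x)) →
           ∀ {σ τ} (x : (τ ∷ Γ) ∋ σ) → exts s x ≡ var (ext r x)
exts-var eq Z     = refl
exts-var eq (S x) = cong (rename S) (eq x)

subst-var : ∀ {Γ Δ} {s : Sub Γ Δ} {r : Ren Γ Δ} → (∀ {σ} (x : Γ ∋ σ) → s x ≡ var (r x)) →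
            ∀ {σ} (M : Tm Γ σ) → subst s M ≡ rename r M
subst-var eq (num n)      = refl
subst-var eq (succ M)     = cong succ (subst-var eq M)
subst-var eq (pred M)     = cong pred (subst-var eq M)
subst-var eq (var x)      = eq x
subst-var eq (coin r p q) = refl
subst-var eq (lett M N)   = cong₂ lett (subst-var eq M) (subst-var (exts-var eq) N)
subst-var eq (iff M N P)  = cong₃ iff (subst-var eq M) (subst-var eq N) (subst-var eq P)
subst-var eq (app M N)    = cong₂ app (subst-var eq M) (subst-var eq N)
subst-var eq (lam M)      = cong lam (subst-var (exts-var eq) M)
subst-var eq (fix M)      = cong fix (subst-var eq M)

-- Substitutions are functions, so the composite is a parameter `u` with a pointwise equation: no
-- function extensionality is involved, and the equation can be carried under a binder.
exts-ext : ∀ {Γ Δ Θ} {s : Sub Δ Θ} {r : Ren Γ Δ} {u : Sub Γ Θ} →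
           (∀ {σ} (x : Γ ∋ σ) → s (r x) ≡ u x) →
           ∀ {σ τ} (x : (τ ∷ Γ) ∋ σ) → exts s (ext r x) ≡ exts u x
exts-ext eq Z     = refl
exts-ext eq (S x) = cong (rename S) (eq x)

subst-rename : ∀ {Γ Δ Θ} {s : Sub Δ Θ} {r : Ren Γ Δ} {u : Sub Γ Θ} →
               (∀ {σ} (x : Γ ∋ σ) → s (r x) ≡ u x) →
               ∀ {σ} (M : Tm Γ σ) → subst s (rename r M) ≡ subst u M
subst-rename eq (num n)      = refl
subst-rename eq (succ M)     = cong succ (subst-rename eq M)
subst-rename eq (pred M)     = cong pred (subst-rename eq M)
subst-rename eq (var x)      = eq x
subst-rename eq (coin r p q) = refl
subst-rename eq (lett M N)   = cong₂ lett (subst-rename eq M) (subst-rename (exts-ext eq) N)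
subst-rename eq (iff M N P)  = cong₃ iff (subst-rename eq M) (subst-rename eq N) (subst-rename eq P)
subst-rename eq (app M N)    = cong₂ app (subst-rename eq M) (subst-rename eq N)
subst-rename eq (lam M)      = cong lam (subst-rename (exts-ext eq) M)
subst-rename eq (fix M)      = cong fix (subst-rename eq M)

rename-rename : ∀ {Γ Δ Θ} (r′ : Ren Δ Θ) (r : Ren Γ Δ) {σ} (M : Tm Γ σ) →
                rename r′ (rename r M) ≡ rename (λ x → r′ (r x)) M
rename-rename r′ r M = begin
  rename r′ (rename r M)           ≡⟨ subst-var (λ x → refl) (rename r M) ⟨
  subst (λ x → var (r′ x)) (rename r M) ≡⟨ subst-rename (λ x → refl) M ⟩
  subst (λ x → var (r′ (r x))) M   ≡⟨ subst-var (λ x → refl) M ⟩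
  rename (λ x → r′ (r x)) M        ∎
  where open ≡-Reasoning

rename-exts : ∀ {Γ Δ Θ} {r : Ren Δ Θ} {s : Sub Γ Δ} {u : Sub Γ Θ} →
              (∀ {σ} (x : Γ ∋ σ) → rename r (s x) ≡ u x) →
              ∀ {σ τ} (x : (τ ∷ Γ) ∋ σ) → rename (ext r) (exts s x) ≡ exts u x
rename-exts eq Z     = refl
rename-exts {r = r} {s} eq (S x) = trans (rename-rename (ext r) S (s x))
  (trans (sym (rename-rename S r (s x))) (cong (rename S) (eq x)))

rename-subst : ∀ {Γ Δ Θ} {r : Ren Δ Θ} {s : Sub Γ Δ} {u : Sub Γ Θ} →
               (∀ {σ} (x : Γ ∋ σ) → rename r (s x) ≡ u x) →
               ∀ {σ} (M : Tm Γ σ) → rename r (subst s M) ≡ subst u M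
rename-subst eq (num n)      = refl
rename-subst eq (succ M)     = cong succ (rename-subst eq M)
rename-subst eq (pred M)     = cong pred (rename-subst eq M)
rename-subst eq (var x)      = eq x
rename-subst eq (coin r p q) = refl
rename-subst eq (lett M N)   = cong₂ lett (rename-subst eq M) (rename-subst (rename-exts eq) N)
rename-subst eq (iff M N P)  = cong₃ iff (rename-subst eq M) (rename-subst eq N) (rename-subst eq P)
rename-subst eq (app M N)    = cong₂ app (rename-subst eq M) (rename-subst eq N)
rename-subst eq (lam M)      = cong lam (rename-subst (rename-exts eq) M)
rename-subst eq (fix M)      = cong fix (rename-subst eq M)

subst-exts : ∀ {Γ Δ Θ} {s′ : Sub Δ Θ} {s : Sub Γ Δ} {u : Sub Γ Θ} →
             (∀ {σ} (x : Γ ∋ σ) → subst s′ (s x) ≡ u x) →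
             ∀ {σ τ} (x : (τ ∷ Γ) ∋ σ) → subst (exts s′) (exts s x) ≡ exts u x
subst-exts eq Z     = refl
subst-exts {s = s} eq (S x) = trans (subst-rename (λ y → refl) (s x))
  (trans (sym (rename-subst (λ y → refl) (s x))) (cong (rename S) (eq x)))

subst-subst : ∀ {Γ Δ Θ} {s′ : Sub Δ Θ} {s : Sub Γ Δ} {u : Sub Γ Θ} →
              (∀ {σ} (x : Γ ∋ σ) → subst s′ (s x) ≡ u x) →
              ∀ {σ} (M : Tm Γ σ) → subst s′ (subst s M) ≡ subst u M
subst-subst eq (num n)      = refl
subst-subst eq (succ M)     = cong succ (subst-subst eq M)
subst-subst eq (pred M)     = cong pred (subst-subst eq M)
subst-subst eq (var x)      = eq x
subst-subst eq (coin r p q) = refl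
subst-subst eq (lett M N)   = cong₂ lett (subst-subst eq M) (subst-subst (subst-exts eq) N)
subst-subst eq (iff M N P)  = cong₃ iff (subst-subst eq M) (subst-subst eq N) (subst-subst eq P)
subst-subst eq (app M N)    = cong₂ app (subst-subst eq M) (subst-subst eq N)
subst-subst eq (lam M)      = cong lam (subst-subst (subst-exts eq) M)
subst-subst eq (fix M)      = cong fix (subst-subst eq M)

exts-id : ∀ {Γ} {s : Sub Γ Γ} → (∀ {σ} (x : Γ ∋ σ) → s x ≡ var x) →
          ∀ {σ τ} (x : (τ ∷ Γ) ∋ σ) → exts s x ≡ var x
exts-id eq Z     = refl
exts-id eq (S x) = cong (rename S) (eq x)

subst-id : ∀ {Γ} {s : Sub Γ Γ} → (∀ {σ} (x : Γ ∋ σ) → s x ≡ var x) →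
           ∀ {σ} (M : Tm Γ σ) → subst s M ≡ M
subst-id eq (num n)      = refl
subst-id eq (succ M)     = cong succ (subst-id eq M)
subst-id eq (pred M)     = cong pred (subst-id eq M)
subst-id eq (var x)      = eq x
subst-id eq (coin r p q) = refl
subst-id eq (lett M N)   = cong₂ lett (subst-id eq M) (subst-id (exts-id eq) N)
subst-id eq (iff M N P)  = cong₃ iff (subst-id eq M) (subst-id eq N) (subst-id eq P)
subst-id eq (app M N)    = cong₂ app (subst-id eq M) (subst-id eq N)
subst-id eq (lam M)      = cong lam (subst-id (exts-id eq) M)
subst-id eq (fix M)      = cong fix (subst-id eq M)

-- Makes beta and `lett` steps commute with closing an open state. Both sides collapse to the
-- substitution `u`.
subst-[] : ∀ {Γ Δ} (s : Sub Γ Δ) {σ τ} (M : Tm (σ ∷ Γ) τ) (N : Tm Γ σ) →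
           subst s (M [ N ]) ≡ subst (exts s) M [ subst s N ]
subst-[] s {σ} M N = trans (subst-subst {u = u} left M) (sym (subst-subst right M))
  where
  u : Sub (σ ∷ _) _
  u Z     = subst s N
  u (S x) = s x
  left : ∀ {τ} (x : (σ ∷ _) ∋ τ) → _
  left Z     = refl
  left (S x) = refl
  right : ∀ {τ} (x : (σ ∷ _) ∋ τ) → _
  right Z     = refl
  right (S x) = trans (subst-rename (λ y → refl) (s x)) (subst-id (λ y → refl) (s x))

subst-closed : ∀ {Δ} (s : Sub Δ []) (r : Ren [] Δ) {σ} (M : Closed σ) →
               subst s (rename r M) ≡ M
subst-closed s r M = trans (subst-rename {u = λ ()} (λ ()) M) (subst-id (λ ()) M)

-- The machine as a step function

-- Parametric in the states, so that the closed and the open machine share one notion of step.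
-- `stuck` is a nonzero numeral on the empty stack, where `Eval` is undefined.
data Step (X : Set) : Set where
  det    : X → Step X
  flip   : (r : ℚ) → 0ℚ ≤ r → r ≤ 1ℚ → X → X → Step X
  accept : Step X
  stuck  : Step X

mapStep : ∀ {X Y} → (X → Y) → Step X → Step Y
mapStep f (det x)           = det (f x)
mapStep f (flip r 0≤r r≤1 x y) = flip r 0≤r r≤1 (f x) (f y)
mapStep f accept            = accept
mapStep f stuck             = stuck

-- The payoff `c` of acceptance varies: it is 1 for `prob`, but depends on `k` when exactly `k`
-- calls are to be counted.
expect : ∀ {X} → ℚ → (X → ℚ) → Step X → ℚ
expect c f (det x)        = f x
expect c f (flip r _ _ x y) = f x * r + f y * (1ℚ - r)
expect c f accept         = c
expect c f stuck          = 0ℚ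

expect-map : ∀ {X Y} c (f : Y → ℚ) (g : X → Y) o → expect c f (mapStep g o) ≡ expect c (f ∘ g) o
expect-map c f g (det x)        = refl
expect-map c f g (flip r _ _ x y) = refl
expect-map c f g accept         = refl
expect-map c f g stuck          = refl

1-nonneg : ∀ {r} → r ≤ 1ℚ → 0ℚ ≤ 1ℚ - r
1-nonneg {r} r≤1 = ℚ.≤-trans (ℚ.≤-reflexive (sym (ℚ.+-inverseʳ r))) (ℚ.+-monoˡ-≤ (- r) r≤1)

expect-mono : ∀ {X c d} {f g : X → ℚ} → c ≤ d → (∀ x → f x ≤ g x) → ∀ o → expect c f o ≤ expect d g o
expect-mono c≤d f≤g (det x)              = f≤g x
expect-mono c≤d f≤g (flip r 0≤r r≤1 x y) =
  ℚ.+-mono-≤ (*-monoˡ 0≤r (f≤g x)) (*-monoˡ (1-nonneg r≤1) (f≤g y))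
expect-mono c≤d f≤g accept               = c≤d
expect-mono c≤d f≤g stuck                = ℚ.≤-refl

expect-const : ∀ {X c} → 0ℚ ≤ c → (o : Step X) → expect c (λ _ → c) o ≤ c
expect-const 0≤c (det x) = ℚ.≤-refl
expect-const {c = c} 0≤c (flip r _ _ x y) = ℚ.≤-reflexive (average c r)
  where
  average : ∀ c r → c * r + c * (1ℚ - r) ≡ c
  average = solve 2 (λ c r → c :* r :+ c :* (con 1ℚ :- r) := c) refl
expect-const 0≤c accept = ℚ.≤-refl
expect-const 0≤c stuck = 0≤c

expect-nonneg : ∀ {X c} {f : X → ℚ} → 0ℚ ≤ c → (∀ x → 0ℚ ≤ f x) → ∀ o → 0ℚ ≤ expect c f o
expect-nonneg 0≤c 0≤f (det x)              = 0≤f x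
expect-nonneg 0≤c 0≤f (flip r 0≤r r≤1 x y) =
  +-nonneg (*-nonneg (0≤f x) 0≤r) (*-nonneg (0≤f y) (1-nonneg r≤1))
expect-nonneg 0≤c 0≤f accept               = 0≤c
expect-nonneg 0≤c 0≤f stuck                = ℚ.≤-refl

stepNum : ℕ → Stack nat → Step State
stepNum zero    ε            = accept
stepNum (suc n) ε            = stuck
stepNum n       (succS π)    = det ⟨ num (suc n) , π ⟩
stepNum zero    (predS π)    = det ⟨ num 0 , π ⟩
stepNum (suc n) (predS π)    = det ⟨ num n , π ⟩
stepNum zero    (ifS N P π)  = det ⟨ N , π ⟩
stepNum (suc n) (ifS N P π)  = det ⟨ P , π ⟩
stepNum n       (letS N π)   = det ⟨ N [ num n ] , π ⟩

step : State → Step State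
step ⟨ num n , π ⟩           = stepNum n π
step ⟨ succ M , π ⟩          = det ⟨ M , succS π ⟩
step ⟨ pred M , π ⟩          = det ⟨ M , predS π ⟩
step ⟨ coin r 0≤r r≤1 , π ⟩  = flip r 0≤r r≤1 ⟨ num 0 , π ⟩ ⟨ num 1 , π ⟩
step ⟨ lett M N , π ⟩        = det ⟨ M , letS N π ⟩
step ⟨ iff M N P , π ⟩       = det ⟨ M , ifS N P π ⟩
step ⟨ app M N , π ⟩         = det ⟨ M , arg N π ⟩
step ⟨ lam M , arg N π ⟩     = det ⟨ M [ N ] , π ⟩
step ⟨ fix M , π ⟩           = det ⟨ M , arg (fix M) π ⟩

-- The supremum over `n` is the sum of the values of `Eval`, by `sum-value≤prob` and
-- `prob≡sum-value`.
prob : ℕ → State → ℚ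
prob zero    s = 0ℚ
prob (suc n) s = expect 1ℚ (prob n) (step s)

prob-nonneg : ∀ n s → 0ℚ ≤ prob n s
prob-nonneg zero    s = ℚ.≤-refl
prob-nonneg (suc n) s = expect-nonneg 0≤1 (prob-nonneg n) (step s)

prob-mono : ∀ {m n} → m ℕ.≤ n → ∀ s → prob m s ≤ prob n s
prob-mono {n = n} ℕ.z≤n   s = prob-nonneg n s
prob-mono (ℕ.s≤s m≤n)     s = expect-mono ℚ.≤-refl (prob-mono m≤n) (step s)

-- Comparison with finite sums of values of Eval

pathStep : ∀ {X} → (X → List Bool → ℚ) → Step X → List Bool → ℚ
pathStep f (det x)          α           = f x α
pathStep f (flip r _ _ x y) []          = 0ℚ
pathStep f (flip r _ _ x y) (false ∷ α) = f x α * r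
pathStep f (flip r _ _ x y) (true ∷ α)  = f y α * (1ℚ - r)
pathStep f accept           []          = 1ℚ
pathStep f accept           (_ ∷ _)     = 0ℚ
pathStep f stuck            α           = 0ℚ

-- The value of Eval at α if a derivation of height at most n defines it, and 0 otherwise.
path : ℕ → State → List Bool → ℚ
path zero    s α = 0ℚ
path (suc n) s α = pathStep (path n) (step s) α

pathStep-mono : ∀ {X} {f g : X → List Bool → ℚ} → (∀ x α → f x α ≤ g x α) →
                ∀ o α → pathStep f o α ≤ pathStep g o α
pathStep-mono f≤g (det x)              α           = f≤g x α
pathStep-mono f≤g (flip r _ _ x y)     []          = ℚ.≤-refl
pathStep-mono f≤g (flip r 0≤r _ x y)   (false ∷ α) = *-monoˡ 0≤r (f≤g x α)
pathStep-mono f≤g (flip r _ r≤1 x y)   (true ∷ α)  = *-monoˡ (1-nonneg r≤1) (f≤g y α)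
pathStep-mono f≤g accept               []          = ℚ.≤-refl
pathStep-mono f≤g accept               (_ ∷ _)     = ℚ.≤-refl
pathStep-mono f≤g stuck                α           = ℚ.≤-refl

pathStep-nonneg : ∀ {X} {f : X → List Bool → ℚ} → (∀ x α → 0ℚ ≤ f x α) →
                  ∀ o α → 0ℚ ≤ pathStep f o α
pathStep-nonneg 0≤f (det x)            α           = 0≤f x α
pathStep-nonneg 0≤f (flip r _ _ x y)   []          = ℚ.≤-refl
pathStep-nonneg 0≤f (flip r 0≤r _ x y) (false ∷ α) = *-nonneg (0≤f x α) 0≤r
pathStep-nonneg 0≤f (flip r _ r≤1 x y) (true ∷ α)  = *-nonneg (0≤f y α) (1-nonneg r≤1)
pathStep-nonneg 0≤f accept             []          = 0≤1
pathStep-nonneg 0≤f accept             (_ ∷ _)     = ℚ.≤-refl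
pathStep-nonneg 0≤f stuck              α           = ℚ.≤-refl

path-nonneg : ∀ n s α → 0ℚ ≤ path n s α
path-nonneg zero    s α = ℚ.≤-refl
path-nonneg (suc n) s α = pathStep-nonneg (path-nonneg n) (step s) α

path-mono : ∀ {m n} → m ℕ.≤ n → ∀ s α → path m s α ≤ path n s α
path-mono {n = n} ℕ.z≤n s α = path-nonneg n s α
path-mono (ℕ.s≤s m≤n)   s α = pathStep-mono (path-mono m≤n) (step s) α

height : ∀ {s α q} → Eval s α q → ℕ
height (e-let D)    = suc (height D)
height (e-app D)    = suc (height D)
height (e-if D)     = suc (height D)
height (e-fix D)    = suc (height D)
height (e-succ D)   = suc (height D)
height (e-pred D)   = suc (height D)
height (e-letv D)   = suc (height D)
height (e-beta D)   = suc (height D)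
height (e-if0 D)    = suc (height D)
height (e-ifS D)    = suc (height D)
height (e-succv D)  = suc (height D)
height (e-pred0 D)  = suc (height D)
height (e-predS D)  = suc (height D)
height (e-coin i D) = suc (height D)
height e-done       = 1

path-height : ∀ {s α q} (D : Eval s α q) → path (height D) s α ≡ q
path-height (e-let D)    = path-height D
path-height (e-app D)    = path-height D
path-height (e-if D)     = path-height D
path-height (e-fix D)    = path-height D
path-height (e-succ D)   = path-height D
path-height (e-pred D)   = path-height D
path-height (e-letv {n = zero} D)    = path-height D
path-height (e-letv {n = suc n} D)   = path-height D
path-height (e-beta D)   = path-height D
path-height (e-if0 D)    = path-height D
path-height (e-ifS D)    = path-height D
path-height (e-succv {n = zero} D)   = path-height D
path-height (e-succv {n = suc n} D)  = path-height D
path-height (e-pred0 D)  = path-height D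
path-height (e-predS D)  = path-height D
path-height (e-coin {r = r} false D) = cong (_* r) (path-height D)
path-height (e-coin {r = r} true D)  = cong (_* (1ℚ - r)) (path-height D)
path-height e-done       = refl

sum : ∀ {X : Set} → (X → ℚ) → List X → ℚ
sum f = foldr (λ x acc → f x + acc) 0ℚ

branch : Bool → List (List Bool) → List (List Bool)
branch i []                = []
branch i ([] ∷ L)          = branch i L
branch false ((false ∷ α) ∷ L) = α ∷ branch false L
branch false ((true ∷ α) ∷ L)  = branch false L
branch true ((false ∷ α) ∷ L)  = branch true L
branch true ((true ∷ α) ∷ L)   = α ∷ branch true L

branch-≢ : ∀ i {α} L → All ((i ∷ α) ≢_) L → All (α ≢_) (branch i L)
branch-≢ i     []                []         = []
branch-≢ i     ([] ∷ L)          (_ ∷ ≢L)   = branch-≢ i L ≢L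
branch-≢ false ((false ∷ _) ∷ L) (≢β ∷ ≢L)  = (λ eq → ≢β (cong (false ∷_) eq)) ∷ branch-≢ false L ≢L
branch-≢ false ((true ∷ _) ∷ L)  (_ ∷ ≢L)   = branch-≢ false L ≢L
branch-≢ true  ((false ∷ _) ∷ L) (_ ∷ ≢L)   = branch-≢ true L ≢L
branch-≢ true  ((true ∷ _) ∷ L)  (≢β ∷ ≢L)  = (λ eq → ≢β (cong (true ∷_) eq)) ∷ branch-≢ true L ≢L

branch-unique : ∀ i L → Unique L → Unique (branch i L)
branch-unique i     []                []         = []
branch-unique i     ([] ∷ L)          (_ ∷ uL)   = branch-unique i L uL
branch-unique false ((false ∷ _) ∷ L) (≢L ∷ uL)  = branch-≢ false L ≢L ∷ branch-unique false L uL
branch-unique false ((true ∷ _) ∷ L)  (_ ∷ uL)   = branch-unique false L uL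
branch-unique true  ((false ∷ _) ∷ L) (_ ∷ uL)   = branch-unique true L uL
branch-unique true  ((true ∷ _) ∷ L)  (≢L ∷ uL)  = branch-≢ true L ≢L ∷ branch-unique true L uL

sum-zero : ∀ {X : Set} {f : X → ℚ} L → All (λ x → f x ≡ 0ℚ) L → sum f L ≡ 0ℚ
sum-zero []      []         = refl
sum-zero (x ∷ L) (eq ∷ eqs) = cong₂ _+_ eq (sum-zero L eqs)

sum-flip : ∀ {X} (f : X → List Bool → ℚ) r {0≤r r≤1} x y L →
           sum (pathStep f (flip r 0≤r r≤1 x y)) L ≡
           sum (f x) (branch false L) * r + sum (f y) (branch true L) * (1ℚ - r)
sum-flip f r x y [] = sym (cong₂ _+_ (ℚ.*-zeroˡ r) (ℚ.*-zeroˡ (1ℚ - r)))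
sum-flip f r x y ([] ∷ L) = trans (ℚ.+-identityˡ _) (sum-flip f r x y L)
sum-flip f r x y ((false ∷ α) ∷ L) = trans (cong (f x α * r +_) (sum-flip f r x y L))
  (left (f x α) r (sum (f x) (branch false L)) (sum (f y) (branch true L) * (1ℚ - r)))
  where
  left : ∀ v r a b → v * r + (a * r + b) ≡ (v + a) * r + b
  left = solve 4 (λ v r a b → v :* r :+ (a :* r :+ b) := (v :+ a) :* r :+ b) refl
sum-flip f r x y ((true ∷ α) ∷ L) = trans (cong (f y α * (1ℚ - r) +_) (sum-flip f r x y L))
  (right (f y α) (1ℚ - r) (sum (f x) (branch false L) * r) (sum (f y) (branch true L)))
  where
  right : ∀ v r a b → v * r + (a + b * r) ≡ a + (v + b) * r
  right = solve 4 (λ v r a b → v :* r :+ (a :+ b :* r) := a :+ (v :+ b) :* r) refl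

-- At a coin the words split according to their first bit, and each branch inherits distinctness. At
-- `accept` distinctness is what lets `[]` be counted only once.
sum-pathStep : ∀ {X} {f : X → List Bool → ℚ} {c : X → ℚ} →
               (∀ x L → Unique L → sum (f x) L ≤ c x) →
               ∀ o L → Unique L → sum (pathStep f o) L ≤ expect 1ℚ c o
sum-pathStep f≤c (det x) L uL = f≤c x L uL
sum-pathStep {f = f} f≤c (flip r 0≤r r≤1 x y) L uL =
  ℚ.≤-trans (ℚ.≤-reflexive (sum-flip f r x y L)) (ℚ.+-mono-≤
    (*-monoˡ 0≤r (f≤c x _ (branch-unique false L uL)))
    (*-monoˡ (1-nonneg r≤1) (f≤c y _ (branch-unique true L uL))))
sum-pathStep f≤c accept [] uL = 0≤1
sum-pathStep {f = f} f≤c accept ([] ∷ L) (≢L ∷ _) = ℚ.≤-reflexive (trans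
  (cong (1ℚ +_) (sum-zero {f = pathStep f accept} L (All.map (λ { {[]} ≢[] → contradiction refl ≢[] ; {_ ∷ _} _ → refl }) ≢L)))
  (ℚ.+-identityʳ 1ℚ))
sum-pathStep {f = f} f≤c accept ((i ∷ α) ∷ L) (_ ∷ uL) =
  ℚ.≤-trans (ℚ.≤-reflexive (ℚ.+-identityˡ _)) (sum-pathStep {f = f} f≤c accept L uL)
sum-pathStep f≤c stuck L uL = ℚ.≤-reflexive (sum-zero L (All.universal (λ _ → refl) L))

sum-path≤prob : ∀ n s L → Unique L → sum (path n s) L ≤ prob n s
sum-path≤prob zero    s L uL = ℚ.≤-reflexive (sum-zero L (All.universal (λ _ → refl) L))
sum-path≤prob (suc n) s L uL = sum-pathStep {f = path n} (sum-path≤prob n) (step s) L uL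

Outcome : State → Set
Outcome s = Σ (List Bool) λ α → Σ ℚ λ q → Eval s α q

value : ∀ {s} → Outcome s → ℚ
value = proj₁ ∘ proj₂

-- The largest height among the finitely many derivations is a number of steps within which all of
-- them are seen.
sum-value≤prob : ∀ {s} (L : List (Outcome s)) → Unique (map proj₁ L) →
                 ∃[ n ] sum value L ≤ prob n s
sum-value≤prob {s} L uL =
  let n , ≤n = sum-value≤path L in n , ℚ.≤-trans ≤n (sum-path≤prob n s (map proj₁ L) uL)
  where
  sum-mono : ∀ {m n} → m ℕ.≤ n → ∀ L → sum (path m s) L ≤ sum (path n s) L
  sum-mono m≤n []      = ℚ.≤-refl
  sum-mono m≤n (α ∷ L) = ℚ.+-mono-≤ (path-mono m≤n s α) (sum-mono m≤n L)
  sum-value≤path : (L : List (Outcome s)) → ∃[ n ] sum value L ≤ sum (path n s) (map proj₁ L)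
  sum-value≤path [] = 0 , ℚ.≤-refl
  sum-value≤path ((α , q , D) ∷ L) =
    let n , ≤n = sum-value≤path L in
    height D ℕ.⊔ n , ℚ.+-mono-≤
      (ℚ.≤-trans (ℚ.≤-reflexive (sym (path-height D))) (path-mono (ℕ.m≤m⊔n (height D) n) s α))
      (ℚ.≤-trans ≤n (sum-mono (ℕ.m≤n⊔m (height D) n) (map proj₁ L)))

-- The rules of `Eval` read as inverse machine steps, grouped by the shape of the step, so that
-- `prob≡sum-value` distinguishes four cases instead of every rule.
Unstep : State → Step State → Set
Unstep s (det s′) = ∀ {α q} → Eval s′ α q → Eval s α q
Unstep s (flip r _ _ s₀ s₁) = (∀ {α q} → Eval s₀ α q → Eval s (false ∷ α) (q * r)) ×
                              (∀ {α q} → Eval s₁ α q → Eval s (true ∷ α) (q * (1ℚ - r)))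
Unstep s accept = Eval s [] 1ℚ
Unstep s stuck  = ⊤

unstep : ∀ s → Unstep s (step s)
unstep ⟨ num zero , ε ⟩              = e-done
unstep ⟨ num (suc n) , ε ⟩           = tt
unstep ⟨ num zero , succS π ⟩        = e-succv
unstep ⟨ num (suc n) , succS π ⟩     = e-succv
unstep ⟨ num zero , predS π ⟩        = e-pred0
unstep ⟨ num (suc n) , predS π ⟩     = e-predS
unstep ⟨ num zero , ifS N P π ⟩      = e-if0
unstep ⟨ num (suc n) , ifS N P π ⟩   = e-ifS
unstep ⟨ num zero , letS N π ⟩       = e-letv
unstep ⟨ num (suc n) , letS N π ⟩    = e-letv
unstep ⟨ succ M , π ⟩                = e-succ
unstep ⟨ pred M , π ⟩                = e-pred
unstep ⟨ coin r 0≤r r≤1 , π ⟩        = e-coin false , e-coin true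
unstep ⟨ lett M N , π ⟩              = e-let
unstep ⟨ iff M N P , π ⟩             = e-if
unstep ⟨ app M N , π ⟩               = e-app
unstep ⟨ lam M , arg N π ⟩           = e-beta
unstep ⟨ fix M , π ⟩                 = e-fix

sum-map : ∀ {X Y : Set} (g : Y → ℚ) (f : X → Y) L → sum g (map f L) ≡ sum (g ∘ f) L
sum-map g f []      = refl
sum-map g f (x ∷ L) = cong (g (f x) +_) (sum-map g f L)

sum-++ : ∀ {X : Set} (g : X → ℚ) L L′ → sum g (L ++ L′) ≡ sum g L + sum g L′
sum-++ g []      L′ = sym (ℚ.+-identityˡ _)
sum-++ g (x ∷ L) L′ = trans (cong (g x +_) (sum-++ g L L′)) (sym (ℚ.+-assoc (g x) (sum g L) (sum g L′)))

sum-*ʳ : ∀ {X : Set} (g : X → ℚ) r L → sum (λ x → g x * r) L ≡ sum g L * r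
sum-*ʳ g r []      = sym (ℚ.*-zeroˡ r)
sum-*ʳ g r (x ∷ L) = trans (cong (g x * r +_) (sum-*ʳ g r L)) (sym (ℚ.*-distribʳ-+ r (g x) (sum g L)))

-- The list collects the accepting runs within `n` steps. At a coin the words of the two branches
-- receive different first bits and so remain distinct.
prob≡sum-value : ∀ n s → Σ (List (Outcome s)) λ L → Unique (map proj₁ L) × prob n s ≡ sum value L
prob≡sum-value zero s = [] , [] , refl
prob≡sum-value (suc n) s with step s | unstep s
... | det s′ | up =
  let L , uL , eq = prob≡sum-value n s′
      f : Outcome s′ → Outcome s
      f = λ (α , q , D) → α , q , up D
  in map f L , Eq.subst Unique (map-∘ L) uL , trans eq (sym (sum-map value f L))
... | flip r 0≤r r≤1 s₀ s₁ | up₀ , up₁ =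
  let L₀ , uL₀ , eq₀ = prob≡sum-value n s₀
      L₁ , uL₁ , eq₁ = prob≡sum-value n s₁
      f₀ : Outcome s₀ → Outcome s
      f₀ = λ (α , q , D) → false ∷ α , q * r , up₀ D
      f₁ : Outcome s₁ → Outcome s
      f₁ = λ (α , q , D) → true ∷ α , q * (1ℚ - r) , up₁ D
      names : map proj₁ (map f₀ L₀ ++ map f₁ L₁) ≡ map (false ∷_) (map proj₁ L₀) ++ map (true ∷_) (map proj₁ L₁)
      names = trans (map-++ proj₁ (map f₀ L₀) (map f₁ L₁)) (cong₂ _++_
        (trans (sym (map-∘ L₀)) (map-∘ L₀)) (trans (sym (map-∘ L₁)) (map-∘ L₁)))
      scaled₀ = trans (sum-map value f₀ L₀) (sum-*ʳ value r L₀)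
      scaled₁ = trans (sum-map value f₁ L₁) (sum-*ʳ value (1ℚ - r) L₁)
  in map f₀ L₀ ++ map f₁ L₁
   , Eq.subst Unique (sym names) (Unique.++⁺
       (Unique.map⁺ (proj₂ ∘ ∷-injective) uL₀) (Unique.map⁺ (proj₂ ∘ ∷-injective) uL₁)
       (λ (∈₀ , ∈₁) → disjoint ∈₀ ∈₁))
   , trans (cong₂ (λ x y → x * r + y * (1ℚ - r)) eq₀ eq₁)
       (sym (trans (sum-++ value (map f₀ L₀) (map f₁ L₁)) (cong₂ _+_ scaled₀ scaled₁)))
  where
  disjoint : ∀ {α K₀ K₁} → α ∈ map (false ∷_) K₀ → α ∈ map (true ∷_) K₁ → ⊥
  disjoint ∈₀ ∈₁ with ∈-map⁻ (false ∷_) ∈₀ | ∈-map⁻ (true ∷_) ∈₁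
  ... | _ , _ , refl | _ , _ , ()
... | accept | D = ([] , 1ℚ , D) ∷ [] , ([] ∷ []) , sym (ℚ.+-identityʳ 1ℚ)
... | stuck | _ = [] , [] , refl

-- Evaluation with one free variable, counting its calls

data OpenStack (σ : Ty) : Ty → Set where
  ε     : OpenStack σ nat
  arg   : ∀ {τ υ} → Tm (σ ∷ []) τ → OpenStack σ υ → OpenStack σ (τ ⇒ υ)
  succS : OpenStack σ nat → OpenStack σ nat
  predS : OpenStack σ nat → OpenStack σ nat
  ifS   : ∀ {τ} → Tm (σ ∷ []) τ → Tm (σ ∷ []) τ → OpenStack σ τ → OpenStack σ nat
  letS  : ∀ {τ} → Tm (nat ∷ σ ∷ []) τ → OpenStack σ τ → OpenStack σ nat

record OpenState (σ : Ty) : Set where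
  constructor ⟪_,_⟫
  field
    {ty}  : Ty
    term  : Tm (σ ∷ []) ty
    stack : OpenStack σ ty

-- A variable at the head is an event of its own, so `openStep` does not mention the answering term.
data Event (σ : Ty) : Set where
  call : OpenStack σ σ → Event σ
  run  : Step (OpenState σ) → Event σ

openStepNum : ∀ {σ} → ℕ → OpenStack σ nat → Step (OpenState σ)
openStepNum zero    ε            = accept
openStepNum (suc n) ε            = stuck
openStepNum n       (succS π)    = det ⟪ num (suc n) , π ⟫
openStepNum zero    (predS π)    = det ⟪ num 0 , π ⟫
openStepNum (suc n) (predS π)    = det ⟪ num n , π ⟫
openStepNum zero    (ifS N P π)  = det ⟪ N , π ⟫
openStepNum (suc n) (ifS N P π)  = det ⟪ P , π ⟫
openStepNum n       (letS N π)   = det ⟪ N [ num n ] , π ⟫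

openStep : ∀ {σ} → OpenState σ → Event σ
openStep ⟪ num n , π ⟫           = run (openStepNum n π)
openStep ⟪ succ M , π ⟫          = run (det ⟪ M , succS π ⟫)
openStep ⟪ pred M , π ⟫          = run (det ⟪ M , predS π ⟫)
openStep ⟪ var Z , π ⟫           = call π
openStep ⟪ coin r 0≤r r≤1 , π ⟫  = run (flip r 0≤r r≤1 ⟪ num 0 , π ⟫ ⟪ num 1 , π ⟫)
openStep ⟪ lett M N , π ⟫        = run (det ⟪ M , letS N π ⟫)
openStep ⟪ iff M N P , π ⟫       = run (det ⟪ M , ifS N P π ⟫)
openStep ⟪ app M N , π ⟫         = run (det ⟪ M , arg N π ⟫)
openStep ⟪ lam M , arg N π ⟫     = run (det ⟪ M [ N ] , π ⟫)
openStep ⟪ fix M , π ⟫           = run (det ⟪ M , arg (fix M) π ⟫)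

call-or-run : ∀ {σ} (o : OpenState σ) →
              (∃[ π ] o ≡ ⟪ var Z , π ⟫) ⊎ (∃[ x ] openStep o ≡ run x)
call-or-run ⟪ num n , π ⟫          = inj₂ (_ , refl)
call-or-run ⟪ succ M , π ⟫         = inj₂ (_ , refl)
call-or-run ⟪ pred M , π ⟫         = inj₂ (_ , refl)
call-or-run ⟪ var Z , π ⟫          = inj₁ (π , refl)
call-or-run ⟪ coin r 0≤r r≤1 , π ⟫ = inj₂ (_ , refl)
call-or-run ⟪ lett M N , π ⟫       = inj₂ (_ , refl)
call-or-run ⟪ iff M N P , π ⟫      = inj₂ (_ , refl)
call-or-run ⟪ app M N , π ⟫        = inj₂ (_ , refl)
call-or-run ⟪ lam M , arg N π ⟫    = inj₂ (_ , refl)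
call-or-run ⟪ fix M , π ⟫          = inj₂ (_ , refl)

-- A closed term is not a variable, so its weakening cannot begin with a call. This keeps two calls
-- from being adjacent in `prob≤series`.
weaken-runs : ∀ {σ τ} (M : Closed τ) (π : OpenStack σ τ) → ∃[ x ] openStep ⟪ weaken M , π ⟫ ≡ run x
weaken-runs (num n)      π         = _ , refl
weaken-runs (succ M)     π         = _ , refl
weaken-runs (pred M)     π         = _ , refl
weaken-runs (coin r p q) π         = _ , refl
weaken-runs (lett M N)   π         = _ , refl
weaken-runs (iff M N P)  π         = _ , refl
weaken-runs (app M N)    π         = _ , refl
weaken-runs (lam M)      (arg N π) = _ , refl
weaken-runs (fix M)      π         = _ , refl

module _ {σ : Ty} (N : Closed σ) where

  closing : Sub (σ ∷ []) []
  closing Z = N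

  closeStack : ∀ {τ} → OpenStack σ τ → Stack τ
  closeStack ε            = ε
  closeStack (arg M π)    = arg (subst closing M) (closeStack π)
  closeStack (succS π)    = succS (closeStack π)
  closeStack (predS π)    = predS (closeStack π)
  closeStack (ifS P Q π)  = ifS (subst closing P) (subst closing Q) (closeStack π)
  closeStack (letS P π)   = letS (subst (exts closing) P) (closeStack π)

  close : OpenState σ → State
  close ⟪ M , π ⟫ = ⟨ subst closing M , closeStack π ⟩

  stepNum-close : ∀ n π → stepNum n (closeStack π) ≡ mapStep close (openStepNum n π)
  stepNum-close zero    ε           = refl
  stepNum-close (suc n) ε           = refl
  stepNum-close zero    (succS π)   = refl
  stepNum-close (suc n) (succS π)   = refl
  stepNum-close zero    (predS π)   = refl
  stepNum-close (suc n) (predS π)   = refl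
  stepNum-close zero    (ifS P Q π) = refl
  stepNum-close (suc n) (ifS P Q π) = refl
  stepNum-close zero    (letS P π)  =
    cong (λ M → det ⟨ M , closeStack π ⟩) (sym (subst-[] closing P (num zero)))
  stepNum-close (suc n) (letS P π)  =
    cong (λ M → det ⟨ M , closeStack π ⟩) (sym (subst-[] closing P (num (suc n))))

  step-close : ∀ o {x} → openStep o ≡ run x → step (close o) ≡ mapStep close x
  step-close ⟪ num n , π ⟫          refl = stepNum-close n π
  step-close ⟪ succ M , π ⟫         refl = refl
  step-close ⟪ pred M , π ⟫         refl = refl
  step-close ⟪ coin r 0≤r r≤1 , π ⟫ refl = refl
  step-close ⟪ lett M P , π ⟫       refl = refl
  step-close ⟪ iff M P Q , π ⟫      refl = refl
  step-close ⟪ app M P , π ⟫        refl = refl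
  step-close ⟪ lam M , arg P π ⟫    refl =
    cong (λ M → det ⟨ M , closeStack π ⟩) (sym (subst-[] closing M P))
  step-close ⟪ fix M , π ⟫          refl = refl
  step-close ⟪ var Z , π ⟫          ()

  close-weaken : ∀ {τ} (M : Closed τ) (π : OpenStack σ τ) → close ⟪ weaken M , π ⟫ ≡ ⟨ M , closeStack π ⟩
  close-weaken M π = cong (λ M → ⟨ M , closeStack π ⟩) (subst-closed closing (λ ()) M)

  prob-close : ∀ n o {x} → openStep o ≡ run x → prob (suc n) (close o) ≡ expect 1ℚ (prob n ∘ close) x
  prob-close n o {x} eq = trans (cong (expect 1ℚ (prob n)) (step-close o eq)) (expect-map 1ℚ (prob n) close x)

-- Generating series of the number of calls

-- Coefficients of the constant series 1: an accepting state makes no further call.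
kronecker : ℕ → ℚ
kronecker zero    = 1ℚ
kronecker (suc k) = 0ℚ

kronecker-nonneg : ∀ k → 0ℚ ≤ kronecker k
kronecker-nonneg zero    = 0≤1
kronecker-nonneg (suc k) = ℚ.≤-refl

series-zero : ∀ K t → series K (λ _ → 0ℚ) t ≡ 0ℚ
series-zero zero    t = refl
series-zero (suc K) t = trans (ℚ.+-identityˡ _) (trans (cong (t *_) (series-zero K t)) (ℚ.*-zeroʳ t))

series-kronecker : ∀ K t → series (suc K) kronecker t ≡ 1ℚ
series-kronecker K t =
  trans (cong (1ℚ +_) (trans (cong (t *_) (series-zero K t)) (ℚ.*-zeroʳ t))) (ℚ.+-identityʳ 1ℚ)

series-kronecker≤1 : ∀ K t → series K kronecker t ≤ 1ℚ
series-kronecker≤1 zero    t = 0≤1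
series-kronecker≤1 (suc K) t = ℚ.≤-reflexive (series-kronecker K t)

series-mix : ∀ K (a b : ℕ → ℚ) r s t →
             series K (λ k → a k * r + b k * s) t ≡ series K a t * r + series K b t * s
series-mix zero    a b r s t = sym (cong₂ _+_ (ℚ.*-zeroˡ r) (ℚ.*-zeroˡ s))
series-mix (suc K) a b r s t = trans
  (cong (λ x → a 0 * r + b 0 * s + t * x) (series-mix K (a ∘ suc) (b ∘ suc) r s t))
  (regroup (a 0) (b 0) (series K (a ∘ suc) t) (series K (b ∘ suc) t) r s t)
  where
  regroup : ∀ a b x y r s t → a * r + b * s + t * (x * r + y * s) ≡ (a + t * x) * r + (b + t * y) * s
  regroup = solve 7 (λ a b x y r s t →
    a :* r :+ b :* s :+ t :* (x :* r :+ y :* s) := (a :+ t :* x) :* r :+ (b :+ t :* y) :* s) refl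

-- Linearity of the series in its coefficients: averaging over a coin may be done before or after
-- summation.
series-expect : ∀ {X} K (f : X → ℕ → ℚ) t x →
                series K (λ k → expect (kronecker k) (λ o → f o k) x) t ≡
                expect (series K kronecker t) (λ o → series K (f o) t) x
series-expect K f t (det o)            = refl
series-expect K f t (flip r _ _ o₀ o₁) = series-mix K (f o₀) (f o₁) r (1ℚ - r) t
series-expect K f t accept             = refl
series-expect K f t stuck              = series-zero K t

module _ {σ : Ty} (M : Closed σ) where

  -- A call uses up one of the `k` calls; on series this shift is multiplication by `t`. The answer
  -- is weakened and run on the open stack, so that later calls from that stack are counted too.
  countEvent : (OpenState σ → ℕ → ℚ) → Event σ → ℕ → ℚ
  countEvent f (call π) zero    = 0ℚ
  countEvent f (call π) (suc k) = f ⟪ weaken M , π ⟫ k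
  countEvent f (run x)  k       = expect (kronecker k) (λ o → f o k) x

  -- count n o k is the probability of acceptance within n steps with exactly k calls
  -- of the free variable, each of them answered by M.
  count : ℕ → OpenState σ → ℕ → ℚ
  count zero    o k = 0ℚ
  count (suc n) o k = countEvent (count n) (openStep o) k

  count-nonneg : ∀ n o k → 0ℚ ≤ count n o k
  count-nonneg zero    o k = ℚ.≤-refl
  count-nonneg (suc n) o k = event (openStep o) k
    where
    event : ∀ e k → 0ℚ ≤ countEvent (count n) e k
    event (call π) zero    = ℚ.≤-refl
    event (call π) (suc k) = count-nonneg n ⟪ weaken M , π ⟫ k
    event (run x)  k       = expect-nonneg (kronecker-nonneg k) (λ o → count-nonneg n o k) x

  count-mono : ∀ {m n} → m ℕ.≤ n → ∀ o k → count m o k ≤ count n o k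
  count-mono {n = n} ℕ.z≤n o k = count-nonneg n o k
  count-mono (ℕ.s≤s {m} {n} m≤n) o k = event (openStep o) k
    where
    event : ∀ e k → countEvent (count m) e k ≤ countEvent (count n) e k
    event (call π) zero    = ℚ.≤-refl
    event (call π) (suc k) = count-mono m≤n ⟪ weaken M , π ⟫ k
    event (run x)  k       = expect-mono ℚ.≤-refl (λ o → count-mono m≤n o k) x

  count-bounded : ∀ n o K → series K (count n o) 1ℚ ≤ 1ℚ
  count-bounded zero    o K = ℚ.≤-trans (ℚ.≤-reflexive (series-zero K 1ℚ)) 0≤1
  count-bounded (suc n) o K = event (openStep o) K
    where
    event : ∀ e K → series K (countEvent (count n) e) 1ℚ ≤ 1ℚ
    event (call π) zero    = 0≤1
    event (call π) (suc K) = ℚ.≤-trans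
      (ℚ.≤-reflexive (trans (ℚ.+-identityˡ _) (ℚ.*-identityˡ _)))
      (count-bounded n ⟪ weaken M , π ⟫ K)
    event (run x) K = begin
      series K (countEvent (count n) (run x)) 1ℚ                       ≡⟨ series-expect K (count n) 1ℚ x ⟩
      expect (series K kronecker 1ℚ) (λ o → series K (count n o) 1ℚ) x ≤⟨ expect-mono (series-kronecker≤1 K 1ℚ) (λ o → count-bounded n o K) x ⟩
      expect 1ℚ (λ _ → 1ℚ) x                                           ≤⟨ expect-const 0≤1 x ⟩
      1ℚ                                                               ∎
      where open ≤-Reasoning

  count-approximation : ∀ o → Approximation (λ n → count n o)
  count-approximation o .Approximation.nonneg n k    = count-nonneg n o k
  count-approximation o .Approximation.mono m≤n k    = count-mono m≤n o k
  count-approximation o .Approximation.bounded K n   = count-bounded n o K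

  series-call : ∀ n π K t → series (suc K) (count (suc n) ⟪ var Z , π ⟫) t ≡ t * series K (count n ⟪ weaken M , π ⟫) t
  series-call n π K t = ℚ.+-identityˡ _

  series-run : ∀ n o {x} → openStep o ≡ run x → ∀ K t →
               series K (count (suc n) o) t ≡ expect (series K kronecker t) (λ o → series K (count n o) t) x
  series-run n o {x} eq K t =
    trans (cong (λ e → series K (countEvent (count n) e) t) eq) (series-expect K (count n) t x)

  module _ (N : Closed σ) {t : ℚ} (0≤t : 0ℚ ≤ t) where

    -- `N` may spend `suc d` steps before it behaves like `M` with weight `t`. Every open step
    -- receives this budget, whence `n * suc d`; a step that is not a call uses one unit, and
    -- monotonicity of `prob` absorbs the rest.
    series≤prob : ∀ d → (∀ n (π : Stack σ) → t * prob n ⟨ M , π ⟩ ≤ prob (suc d ℕ.+ n) ⟨ N , π ⟩) →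
                  ∀ n o K → series K (count n o) t ≤ prob (n ℕ.* suc d) (close N o)
    series≤prob d simulates zero    o K = ℚ.≤-reflexive (series-zero K t)
    series≤prob d simulates (suc n) o K with call-or-run o
    series≤prob d simulates (suc n) o zero | inj₁ (π , refl) = prob-nonneg (suc n ℕ.* suc d) (close N o)
    series≤prob d simulates (suc n) o (suc K) | inj₁ (π , refl) = begin
      series (suc K) (count (suc n) ⟪ var Z , π ⟫) t           ≡⟨ series-call n π K t ⟩
      t * series K (count n ⟪ weaken M , π ⟫) t                ≤⟨ *-monoʳ 0≤t (series≤prob d simulates n ⟪ weaken M , π ⟫ K) ⟩
      t * prob (n ℕ.* suc d) (close N ⟪ weaken M , π ⟫)        ≡⟨ cong (λ s → t * prob (n ℕ.* suc d) s) (close-weaken N M π) ⟩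
      t * prob (n ℕ.* suc d) ⟨ M , closeStack N π ⟩            ≤⟨ simulates (n ℕ.* suc d) (closeStack N π) ⟩
      prob (suc n ℕ.* suc d) ⟨ N , closeStack N π ⟩            ∎
      where open ≤-Reasoning
    series≤prob d simulates (suc n) o K | inj₂ (x , eq) = begin
      series K (count (suc n) o) t                                        ≡⟨ series-run n o eq K t ⟩
      expect (series K kronecker t) (λ o → series K (count n o) t) x      ≤⟨ expect-mono (series-kronecker≤1 K t) (λ o → ℚ.≤-trans
                                                                               (series≤prob d simulates n o K)
                                                                               (prob-mono (ℕ.m≤n+m (n ℕ.* suc d) d) (close N o))) x ⟩
      expect 1ℚ (prob (d ℕ.+ n ℕ.* suc d) ∘ close N) x                    ≡⟨ prob-close N (d ℕ.+ n ℕ.* suc d) o eq ⟨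
      prob (suc n ℕ.* suc d) (close N o)                                  ∎
      where open ≤-Reasoning

    -- A call takes no step when N = M, but it is never followed by another call.
    prob≤series : (∀ n (π : Stack σ) → prob n ⟨ N , π ⟩ ≤ t * prob n ⟨ M , π ⟩) →
                  ∀ n o → prob n (close N o) ≤ series (n ℕ.* 2) (count (n ℕ.* 2) o) t
    prob≤series simulates zero    o = ℚ.≤-refl
    prob≤series simulates (suc n) o = split (call-or-run o)
      where
      open ≤-Reasoning
      m = n ℕ.* 2
      -- One closed step is matched by one open step; the bound `suc m` leaves one of the two units
      -- per closed step for a preceding call. The positive length makes the series of `kronecker`
      -- equal to 1.
      after-run : ∀ o {x} → openStep o ≡ run x → prob (suc n) (close N o) ≤ series (suc m) (count (suc m) o) t
      after-run o {x} eq = begin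
        prob (suc n) (close N o)                                                        ≡⟨ prob-close N n o eq ⟩
        expect 1ℚ (prob n ∘ close N) x                                                  ≤⟨ expect-mono (ℚ.≤-reflexive (sym (series-kronecker m t))) (λ o → ℚ.≤-trans
                                                                                             (prob≤series simulates n o)
                                                                                             (series-length-mono (ℕ.n≤1+n m) 0≤t (count-nonneg m o))) x ⟩
        expect (series (suc m) kronecker t) (λ o → series (suc m) (count m o) t) x      ≡⟨ series-run m o eq (suc m) t ⟨
        series (suc m) (count (suc m) o) t                                              ∎
      split : (∃[ π ] o ≡ ⟪ var Z , π ⟫) ⊎ (∃[ x ] openStep o ≡ run x) →
              prob (suc n) (close N o) ≤ series (suc (suc m)) (count (suc (suc m)) o) t
      split (inj₁ (π , refl)) = begin
        prob (suc n) ⟨ N , closeStack N π ⟩                              ≤⟨ simulates (suc n) (closeStack N π) ⟩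
        t * prob (suc n) ⟨ M , closeStack N π ⟩                          ≡⟨ cong (λ s → t * prob (suc n) s) (close-weaken N M π) ⟨
        t * prob (suc n) (close N ⟪ weaken M , π ⟫)                      ≤⟨ *-monoʳ 0≤t (after-run ⟪ weaken M , π ⟫ (proj₂ (weaken-runs M π))) ⟩
        t * series (suc m) (count (suc m) ⟪ weaken M , π ⟫) t            ≡⟨ series-call (suc m) π (suc m) t ⟨
        series (suc (suc m)) (count (suc (suc m)) ⟪ var Z , π ⟫) t       ∎
      split (inj₂ (x , eq)) = begin
        prob (suc n) (close N o)                          ≤⟨ after-run o eq ⟩
        series (suc m) (count (suc m) o) t                ≤⟨ series-length-mono (ℕ.n≤1+n (suc m)) 0≤t (count-nonneg (suc m) o) ⟩
        series (suc (suc m)) (count (suc m) o) t          ≤⟨ series-mono (suc (suc m)) 0≤t (count-mono (ℕ.n≤1+n (suc m)) o) ⟩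
        series (suc (suc m)) (count (suc (suc m)) o) t    ∎

-- Guards: answering a call with a given probability

guard : ∀ {σ} (r : ℚ) → 0ℚ ≤ r → r ≤ 1ℚ → Closed σ → Closed σ
guard {σ} r 0≤r r≤1 M = iff (coin r 0≤r r≤1) M (Ω σ)

-- `Ω σ` returns to itself, on the same stack, after the two steps `fix` and beta.
prob-Ω : ∀ n {σ} (π : Stack σ) → prob n ⟨ Ω σ , π ⟩ ≡ 0ℚ
prob-Ω zero          π = refl
prob-Ω (suc zero)    π = refl
prob-Ω (suc (suc n)) π = prob-Ω n π

-- The three steps push the test, flip the coin and take the branch; the branch `Ω` contributes
-- nothing.
prob-guard : ∀ n {r 0≤r r≤1 σ} (M : Closed σ) π →
             prob (3 ℕ.+ n) ⟨ guard r 0≤r r≤1 M , π ⟩ ≡ r * prob n ⟨ M , π ⟩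
prob-guard n {r} M π = begin
  prob n ⟨ M , π ⟩ * r + prob n ⟨ Ω _ , π ⟩ * (1ℚ - r) ≡⟨ cong (λ x → prob n ⟨ M , π ⟩ * r + x * (1ℚ - r)) (prob-Ω n π) ⟩
  prob n ⟨ M , π ⟩ * r + 0ℚ * (1ℚ - r)                 ≡⟨ cong (prob n ⟨ M , π ⟩ * r +_) (ℚ.*-zeroˡ (1ℚ - r)) ⟩
  prob n ⟨ M , π ⟩ * r + 0ℚ                            ≡⟨ ℚ.+-identityʳ _ ⟩
  prob n ⟨ M , π ⟩ * r                                 ≡⟨ ℚ.*-comm (prob n ⟨ M , π ⟩) r ⟩
  r * prob n ⟨ M , π ⟩                                 ∎
  where open ≡-Reasoning

prob-guard≤ : ∀ n {r 0≤r r≤1 σ} (M : Closed σ) π →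
              prob n ⟨ guard r 0≤r r≤1 M , π ⟩ ≤ r * prob n ⟨ M , π ⟩
prob-guard≤ n {r} {0≤r} {r≤1} M π = ℚ.≤-trans
  (prob-mono (ℕ.m≤n+m n 3) ⟨ guard r 0≤r r≤1 M , π ⟩)
  (ℚ.≤-reflexive (prob-guard n {r} {0≤r} {r≤1} M π))

-- The two steps push the argument and perform beta, which turns the body of `tame` into a guarded
-- argument of `C`.
prob-tame : ∀ n {σ p 0≤p p≤1} (C : Closed (σ ⇒ nat)) M π →
            prob (2 ℕ.+ n) ⟨ app (tame p 0≤p p≤1 C) M , π ⟩ ≡ prob n ⟨ app C (guard p 0≤p p≤1 M) , π ⟩
prob-tame n {p = p} {0≤p} {p≤1} C M π =
  cong (λ D → prob n ⟨ app D (guard p 0≤p p≤1 M) , π ⟩) (subst-closed _ (λ ()) C)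

-- From tamed contexts to arbitrary contexts

_≼_ : State → State → Set
s ≼ s′ = ∀ n e → 0ℚ < e → ∃[ m ] prob n s ≤ prob m s′ + e

≤ℙ⇒≼ : ∀ {M M′} → M ≤ℙ M′ → ⟨ M , ε ⟩ ≼ ⟨ M′ , ε ⟩
≤ℙ⇒≼ {M} {M′} M≤M′ n e 0<e =
  let L , uL , eq = prob≡sum-value n ⟨ M , ε ⟩
      (L′ , uL′) , ≤L′ = M≤M′ (L , uL) e 0<e
      m , ≤m = sum-value≤prob L′ uL′
  in m , ℚ.≤-trans (ℚ.≤-reflexive eq) (ℚ.≤-trans ≤L′ (ℚ.+-monoˡ-≤ e ≤m))

≼⇒≤ℙ : ∀ {M M′} → ⟨ M , ε ⟩ ≼ ⟨ M′ , ε ⟩ → M ≤ℙ M′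
≼⇒≤ℙ {M} {M′} M≼M′ (L , uL) e 0<e =
  let n , ≤n = sum-value≤prob L uL
      m , ≤m = M≼M′ n e 0<e
      L′ , uL′ , eq = prob≡sum-value m ⟨ M′ , ε ⟩
  in (L′ , uL′) , ℚ.≤-trans ≤n (ℚ.≤-trans ≤m (ℚ.≤-reflexive (cong (_+ e) eq)))

module _ {σ : Ty} (C : Closed (σ ⇒ nat)) where

  -- With a variable as argument, every use that `C` makes of it appears as a `call`.
  context : OpenState σ
  context = ⟪ app (weaken C) (var Z) , ε ⟫

  close-context : ∀ N → close N context ≡ ⟨ app C N , ε ⟩
  close-context N = cong (λ D → ⟨ app D N , ε ⟩) (subst-closed (closing N) (λ ()) C)

  -- The outer taming `p` is imposed by the distance, the inner `q` is free. A call passes both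
  -- guards, so its weight is `q * p`.
  tamed⇒≤ : ∀ {p 0≤p p≤1 q 0≤q q≤1} (M M′ : Closed σ) →
            ⟨ app (tame p 0≤p p≤1 (tame q 0≤q q≤1 C)) M , ε ⟩ ≼
            ⟨ app (tame p 0≤p p≤1 (tame q 0≤q q≤1 C)) M′ , ε ⟩ →
            (λ n → count M n context) ≤[ q * p ] (λ n → count M′ n context)
  tamed⇒≤ {p} {0≤p} {p≤1} {q} {0≤q} {q≤1} M M′ M≼M′ K n e 0<e = m ℕ.* 2 , m ℕ.* 2 , (begin
    series K (count M n context) (q * p)                       ≤⟨ series≤prob M (N M) 0≤qp 5 (λ k π → ℚ.≤-reflexive (below k π)) n context K ⟩
    prob (n ℕ.* 6) (close (N M) context)                       ≡⟨ cong (prob (n ℕ.* 6)) (close-context (N M)) ⟩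
    prob (n ℕ.* 6) ⟨ app C (N M) , ε ⟩                         ≡⟨ unfold (n ℕ.* 6) M ⟨
    prob (4 ℕ.+ n ℕ.* 6) ⟨ app D M , ε ⟩                       ≤⟨ proj₂ found ⟩
    prob m ⟨ app D M′ , ε ⟩ + e                                ≤⟨ ℚ.+-monoˡ-≤ e (begin
      prob m ⟨ app D M′ , ε ⟩                                    ≤⟨ prob-mono (ℕ.m≤n+m m 4) ⟨ app D M′ , ε ⟩ ⟩
      prob (4 ℕ.+ m) ⟨ app D M′ , ε ⟩                            ≡⟨ unfold m M′ ⟩
      prob m ⟨ app C (N M′) , ε ⟩                                ≡⟨ cong (prob m) (close-context (N M′)) ⟨
      prob m (close (N M′) context)                              ≤⟨ prob≤series M′ (N M′) 0≤qp above m context ⟩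
      series (m ℕ.* 2) (count M′ (m ℕ.* 2) context) (q * p)      ∎) ⟩
    series (m ℕ.* 2) (count M′ (m ℕ.* 2) context) (q * p) + e  ∎)
    where
    open ≤-Reasoning
    D = tame p 0≤p p≤1 (tame q 0≤q q≤1 C)
    N : Closed σ → Closed σ
    N M = guard q 0≤q q≤1 (guard p 0≤p p≤1 M)
    0≤qp = *-nonneg 0≤q 0≤p
    -- Unfolding the two tamings takes 2 steps each, hence 4; passing the two guards takes 3 steps
    -- each, hence 6 per call.
    found = M≼M′ (4 ℕ.+ n ℕ.* 6) e 0<e
    m = proj₁ found
    unfold : ∀ k M → prob (4 ℕ.+ k) ⟨ app D M , ε ⟩ ≡ prob k ⟨ app C (N M) , ε ⟩
    unfold k M = trans (prob-tame (2 ℕ.+ k) {0≤p = 0≤p} {p≤1} (tame q 0≤q q≤1 C) M ε) (prob-tame k {0≤p = 0≤q} {q≤1} C (guard p 0≤p p≤1 M) ε)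
    below : ∀ k π → q * p * prob k ⟨ M , π ⟩ ≡ prob (6 ℕ.+ k) ⟨ N M , π ⟩
    below k π = trans (ℚ.*-assoc q p (prob k ⟨ M , π ⟩)) (sym (trans
      (prob-guard (3 ℕ.+ k) {q} {0≤q} {q≤1} (guard p 0≤p p≤1 M) π) (cong (q *_) (prob-guard k {p} {0≤p} {p≤1} M π))))
    above : ∀ k π → prob k ⟨ N M′ , π ⟩ ≤ q * p * prob k ⟨ M′ , π ⟩
    above k π = begin
      prob k ⟨ N M′ , π ⟩                        ≤⟨ prob-guard≤ k (guard p 0≤p p≤1 M′) π ⟩
      q * prob k ⟨ guard p 0≤p p≤1 M′ , π ⟩      ≤⟨ *-monoʳ 0≤q (prob-guard≤ k M′ π) ⟩
      q * (p * prob k ⟨ M′ , π ⟩)                ≡⟨ ℚ.*-assoc q p (prob k ⟨ M′ , π ⟩) ⟨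
      q * p * prob k ⟨ M′ , π ⟩                  ∎

  -- Taming `C` by `q = t / p` yields the weight `t`; the condition t ≤ p makes `q` a probability.
  dObsZero⇒≤ : ∀ {p 0≤p p≤1} → 0ℚ < p → (M M′ : Closed σ) →
               (∀ D → ⟨ app (tame p 0≤p p≤1 D) M , ε ⟩ ≼ ⟨ app (tame p 0≤p p≤1 D) M′ , ε ⟩) →
               ∀ t → 0ℚ < t → t ≤ p → (λ n → count M n context) ≤[ t ] (λ n → count M′ n context)
  dObsZero⇒≤ {p} 0<p M M′ M≼M′ t 0<t t≤p =
    Eq.subst (λ t → (λ n → count M n context) ≤[ t ] (λ n → count M′ n context)) qp≡t
      (tamed⇒≤ M M′ (M≼M′ (tame q 0≤q q≤1 C)))
    where
    instance
      p-positive = positive 0<p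
      p-nonZero = ℚ.pos⇒nonZero p
    q = t * 1/ p
    qp≡t : q * p ≡ t
    qp≡t = trans (ℚ.*-assoc t (1/ p) p) (trans (cong (t *_) (ℚ.*-inverseˡ p)) (ℚ.*-identityʳ t))
    0≤q : 0ℚ ≤ q
    0≤q = *-nonneg (ℚ.<⇒≤ 0<t) (ℚ.<⇒≤ (ℚ.positive⁻¹ (1/ p) {{ℚ.1/pos⇒pos p}}))
    q≤1 : q ≤ 1ℚ
    q≤1 = ℚ.*-cancelʳ-≤-pos p (ℚ.≤-trans (ℚ.≤-reflexive qp≡t)
      (ℚ.≤-trans t≤p (ℚ.≤-reflexive (sym (ℚ.*-identityˡ p)))))

  -- At t = 1 the unguarded answers `M` and `M′` themselves satisfy the simulation hypotheses, so
  -- the two bounds that served the tamed contexts now relate the counts to `C` alone.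
  ≼-context : ∀ {p 0≤p p≤1} → 0ℚ < p → (M M′ : Closed σ) →
              (∀ D → ⟨ app (tame p 0≤p p≤1 D) M , ε ⟩ ≼ ⟨ app (tame p 0≤p p≤1 D) M′ , ε ⟩) →
              (∀ D → ⟨ app (tame p 0≤p p≤1 D) M′ , ε ⟩ ≼ ⟨ app (tame p 0≤p p≤1 D) M , ε ⟩) →
              ⟨ app C M , ε ⟩ ≼ ⟨ app C M′ , ε ⟩
  ≼-context {p≤1 = p≤1} 0<p M M′ M≼M′ M′≼M n e 0<e = m ℕ.* 1 , (begin
    prob n ⟨ app C M , ε ⟩                                   ≡⟨ cong (prob n) (close-context M) ⟨
    prob n (close M context)                                 ≤⟨ prob≤series M M 0≤1 (λ k π → ℚ.≤-reflexive (sym (ℚ.*-identityˡ _))) n context ⟩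
    series (n ℕ.* 2) (count M (n ℕ.* 2) context) 1ℚ          ≤⟨ proj₂ found ⟩
    series (n ℕ.* 2) (count M′ m context) 1ℚ + e             ≤⟨ ℚ.+-monoˡ-≤ e (series≤prob M′ M′ 0≤1 0 same m context (n ℕ.* 2)) ⟩
    prob (m ℕ.* 1) (close M′ context) + e                    ≡⟨ cong (λ s → prob (m ℕ.* 1) s + e) (close-context M′) ⟩
    prob (m ℕ.* 1) ⟨ app C M′ , ε ⟩ + e                      ∎)
    where
    open ≤-Reasoning
    found = series₁≤ 0<p p≤1 (n ℕ.* 2) (count-approximation M context) (count-approximation M′ context)
      (dObsZero⇒≤ 0<p M M′ M≼M′) (dObsZero⇒≤ 0<p M′ M M′≼M) (n ℕ.* 2) e 0<e
    m = proj₁ found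
    same : ∀ k π → 1ℚ * prob k ⟨ M′ , π ⟩ ≤ prob (1 ℕ.+ k) ⟨ M′ , π ⟩
    same k π = ℚ.≤-trans (ℚ.≤-reflexive (ℚ.*-identityˡ _)) (prob-mono (ℕ.n≤1+n k) ⟨ M′ , π ⟩)

theorem4p2 : (p : ℚ) (0<p : 0ℚ < p) (0≤p : 0ℚ ≤ p) (p≤1 : p ≤ 1ℚ)
    {σ : Ty} (M M' : Closed σ) →
    dObsZero p 0≤p p≤1 M M' → ObsEquiv M M'
theorem4p2 p 0<p 0≤p p≤1 M M' d≡0 C =
  ≼⇒≤ℙ (≼-context C 0<p M M' forth back) , ≼⇒≤ℙ (≼-context C 0<p M' M back forth)
  where
  forth : ∀ D → ⟨ app (tame p 0≤p p≤1 D) M , ε ⟩ ≼ ⟨ app (tame p 0≤p p≤1 D) M' , ε ⟩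
  forth D = ≤ℙ⇒≼ (proj₁ (d≡0 D))
  back : ∀ D → ⟨ app (tame p 0≤p p≤1 D) M' , ε ⟩ ≼ ⟨ app (tame p 0≤p p≤1 D) M , ε ⟩
  back D = ≤ℙ⇒≼ (proj₂ (d≡0 D))
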